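{- Let $D,Q\in\mathbb N$ with $(D,Q)=1$ and $D/Q>1$, and suppose $D/Q$ is not the square of a rational number. Let $m\ge 0$ be the smallest integer such that $\sqrt{D/Q}$ has the periodic continued fraction expansion $\sqrt{D/Q}=[b_0,\{b_1,\ldots,b_m,2b_0\}]$ with $b_0,\ldots,b_m\in\mathbb N$, and let $r_k/s_k$, $k=0,1,2,\ldots$, be the $k$th convergent of $\sqrt{D/Q}$. Let $r_k+s_k\sqrt{D/Q}$ be a regular unit, i.e., $k=l(m+1)-1$ for some $l\in\mathbb N$. Let $t\in\mathbb N$ be a divisor of $s_k$, and let $$r_k/t=[c_0,\ldots,c_n]$$ be the (finite) continued fraction expansion of the rational number $r_k/t$ with $n\equiv k \bmod 2$. Then $$(s_k/t)\sqrt{D/Q}=[c_0,\{c_1,\ldots,c_n,2c_0\}].$$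
   Context: $\mathbb N=\{1,2,3,\ldots\}$ and $(a,b)$ denotes the greatest common divisor. The notation $[b_0,\{b_1,\ldots,b_m,2b_0\}]$ denotes the infinite simple continued fraction with initial term $b_0$ followed by the block $b_1,\ldots,b_m,2b_0$ (of length $m+1$) repeated periodically forever; for $D/Q>1$ as in the claim, $\sqrt{D/Q}$ always has an expansion of this form. Convergents $r_k/s_k=[b_0,b_1,\ldots,b_k]$ are indexed from $k=0$ and written in lowest terms with $r_k,s_k\in\mathbb N$, $(r_k,s_k)=1$. Regular units: let $q$ be the smallest positive divisor of $Q$ such that $Q\mid q^2$, let $D_1=Dq^2/Q\in\mathbb N$ and $D_2=DQ=D_1(Q/q)^2$, so that $\mathbb Z[\sqrt{D_2}]\subseteq\mathbb Z[\sqrt{D_1}]$. A unit of $\mathbb Z[\sqrt{D_1}]$ is called regular if it lies in $\mathbb Z[\sqrt{D_2}]$. The number $r_k+s_k\sqrt{D/Q}$ is a regular unit if and only if $k=l(m+1)-1$ for some $l\in\mathbb N$. Finite continued fractions $[c_0,\ldots,c_n]$ of rational numbers are simple ($c_0\in\mathbb Z$, $c_i\in\mathbb N$ for $i\ge1$), and the last term $c_n$ is not required to be $\ge 2$; thus the parity of $n$ can be prescribed, by replacing a last term $c_n\geq 2$ by the two terms $c_n-1,1$ if necessary. -}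

module Defs where

open import Data.Integer.Base as ℤ using (ℤ; +_; +[1+_]; -[1+_]; +0)
open import Data.Nat.Base as ℕ using (ℕ; zero; suc)
import Data.Nat.DivMod as ℕ
open import Data.Rational.Base
open import Data.Rational.Properties
open import Data.Rational.Solver using (module +-*-Solver)
open import Data.Fin.Base using (toℕ)
open import Data.Product.Base using (∃; _×_; _,_)
open import Data.Sum.Base using (_⊎_; inj₁; inj₂)
open import Data.Vec.Base using (Vec; []; _∷_; _∷ʳ_; lookup; tabulate)
open import Data.Vec.Relation.Unary.All using (All)
open import Relation.Binary.PropositionalEquality
open import Relation.Nullary using (¬_; Dec; yes; no; contradiction)

-- Junk value: recip 0ℚ = 0ℚ.
recip : ℚ → ℚ
recip   (mkℚ +0       _ _) = 0ℚ
recip p@(mkℚ +[1+ _ ] _ _) = 1/ p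
recip p@(mkℚ -[1+ _ ] _ _) = 1/ p

*-recip : ∀ p .{{_ : Positive p}} → p * recip p ≡ 1ℚ
*-recip p@(mkℚ +[1+ _ ] _ _) = *-inverseʳ p

recip-pos : ∀ p .{{_ : Positive p}} → Positive (recip p)
recip-pos p@(mkℚ +[1+ _ ] _ _) = 1/pos⇒pos p

-- A real α is the Dedekind cut of the rationals L (q < α) and U (α < q).
record ℝ : Set₁ where
  field
    L U         : ℚ → Set
    L-inhabited : ∃ L
    U-inhabited : ∃ U
    L-closed    : ∀ {p q} → p < q → L q → L p
    U-closed    : ∀ {p q} → p < q → U p → U q
    L-open      : ∀ {p} → L p → ∃ λ q → p < q × L q
    U-open      : ∀ {q} → U q → ∃ λ p → p < q × U p
    disjoint    : ∀ {q} → L q → ¬ U q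
    located     : ∀ {p q} → p < q → L p ⊎ U q

open ℝ

module _ where
  open +-*-Solver

  p<q⇒0<q-p : ∀ {p q} → p < q → 0ℚ < q - p
  p<q⇒0<q-p {p} {q} p<q = subst (_< q - p) (+-inverseʳ p) (+-monoˡ-< (- p) p<q)

  p<p+q : ∀ p {q} → 0ℚ < q → p < p + q
  p<p+q p {q} 0<q = subst (_< p + q) (+-identityʳ p) (+-monoʳ-< p 0<q)

  0<+ : ∀ {p q} → 0ℚ < p → 0ℚ < q → 0ℚ < p + q
  0<+ 0<p 0<q = +-mono-< 0<p 0<q

  0<* : ∀ {p q} → 0ℚ < p → 0ℚ < q → 0ℚ < p * q
  0<* {p} {q} 0<p 0<q =
    positive⁻¹ (p * q) {{pos*pos⇒pos p {{positive 0<p}} q {{positive 0<q}}}}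

  0≤* : ∀ {p q} → 0ℚ ≤ p → 0ℚ ≤ q → 0ℚ ≤ p * q
  0≤* {p} {q} 0≤p 0≤q = subst (_≤ p * q) (*-zeroʳ p)
    (*-monoˡ-≤-nonNeg p {{nonNegative 0≤p}} 0≤q)

  0<1 : 0ℚ < 1ℚ
  0<1 = positive⁻¹ 1ℚ

  sq-mono-< : ∀ {p q} → 0ℚ ≤ p → p < q → p * p < q * q
  sq-mono-< {p} {q} 0≤p p<q = ≤-<-trans
    (*-monoˡ-≤-nonNeg p {{nonNegative 0≤p}} (<⇒≤ p<q))
    (*-monoˡ-<-pos q {{positive (≤-<-trans 0≤p p<q)}} p<q)

  divide : ∀ {n d} → 0ℚ < n → 0ℚ < d → ∃ λ δ → 0ℚ < δ × d * δ ≡ n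
  divide {n} {d} 0<n 0<d = n * recip d , 0<* 0<n (positive⁻¹ _ {{recip-pos d}}) , (begin
    d * (n * recip d)  ≡⟨ solve 3 (λ d n i → d :* (n :* i) := n :* (d :* i)) refl d n (recip d) ⟩
    n * (d * recip d)  ≡⟨ cong (n *_) (*-recip d) ⟩
    n * 1ℚ             ≡⟨ *-identityʳ n ⟩
    n                  ∎)
    where
    open ≡-Reasoning
    instance _ = positive 0<d

  √-L-open : ∀ x {p} → 0ℚ ≤ p → p * p < x → ∃ λ q → p < q × q * q < x
  √-L-open x {p} 0≤p pp<x = step (divide (p<q⇒0<q-p pp<x) 0<d)
    where
    open ≤-Reasoning
    0≤x : 0ℚ ≤ x
    0≤x = ≤-trans (0≤* 0≤p 0≤p) (<⇒≤ pp<x)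
    d = x + (p + p) + 1ℚ
    0<d : 0ℚ < d
    0<d = +-mono-≤-< (+-mono-≤ 0≤x (+-mono-≤ 0≤p 0≤p)) 0<1
    expand : ∀ p δ → (p + δ) * (p + δ) ≡ p * p + (p + p) * δ + δ * δ
    expand = solve 2 (λ p δ →
      (p :+ δ) :* (p :+ δ) := p :* p :+ (p :+ p) :* δ :+ δ :* δ) refl
    -- The unit 1ℚ is a variable here: the solver is very slow on constants.
    collect : ∀ p δ x u → p * p + (p + p) * δ + δ * u + x * δ ≡ p * p + (x + (p + p) + u) * δ
    collect = solve 4 (λ p δ x u →
      p :* p :+ (p :+ p) :* δ :+ δ :* u :+ x :* δ := p :* p :+ (x :+ (p :+ p) :+ u) :* δ) refl
    cancel : ∀ a b u x → (x - a) + (a + b + u) ≡ x + b + u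
    cancel = solve 4 (λ a b u x → (x :+ :- a) :+ (a :+ b :+ u) := x :+ b :+ u) refl
    step : (∃ λ δ → 0ℚ < δ × d * δ ≡ x - p * p) → ∃ λ q → p < q × q * q < x
    step (δ , 0<δ , dδ≡n) = p + δ , p<p+q p 0<δ , (begin-strict
      (p + δ) * (p + δ)                      ≡⟨ expand p δ ⟩
      p * p + (p + p) * δ + δ * δ            <⟨ +-monoʳ-< (p * p + (p + p) * δ) δδ<δ ⟩
      p * p + (p + p) * δ + δ * 1ℚ           ≡⟨ +-identityʳ _ ⟨
      p * p + (p + p) * δ + δ * 1ℚ + 0ℚ      ≤⟨ +-monoʳ-≤ (p * p + (p + p) * δ + δ * 1ℚ)
                                                  (0≤* 0≤x (<⇒≤ 0<δ)) ⟩
      p * p + (p + p) * δ + δ * 1ℚ + x * δ   ≡⟨ collect p δ x 1ℚ ⟩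
      p * p + d * δ                          ≡⟨ cong (λ n → p * p + n) dδ≡n ⟩
      p * p + (x - p * p)                    ≡⟨ solve 2 (λ a x → a :+ (x :+ :- a) := x) refl (p * p) x ⟩
      x                                      ∎)
      where
      δ<1 : δ < 1ℚ
      δ<1 = *-cancelˡ-<-nonNeg d {{nonNegative (<⇒≤ 0<d)}} (begin-strict
        d * δ                                      ≡⟨ dδ≡n ⟩
        x - p * p                                  <⟨ p<p+q (x - p * p)
                                                        (+-mono-≤-< (+-mono-≤ (0≤* 0≤p 0≤p)
                                                          (+-mono-≤ 0≤p 0≤p)) 0<1) ⟩
        (x - p * p) + (p * p + (p + p) + 1ℚ)       ≡⟨ cancel (p * p) (p + p) 1ℚ x ⟩
        d                                          ≡⟨ *-identityʳ d ⟨
        d * 1ℚ                                     ∎)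
      δδ<δ : δ * δ < δ * 1ℚ
      δδ<δ = *-monoʳ-<-pos δ {{positive 0<δ}} δ<1

  √-U-open : ∀ x {q} → 0ℚ < q → x < q * q → ∃ λ p → p < q × 0ℚ < p × x < p * p
  √-U-open x {q} 0<q x<qq with 0ℚ <? x
  ... | no  0≮x = let p , 0<p , p<q = <-dense 0<q in
                  p , p<q , 0<p , ≤-<-trans (≮⇒≥ 0≮x) (0<* 0<p 0<p)
  ... | yes 0<x = step (divide (p<q⇒0<q-p x<qq) (0<+ 0<q 0<q))
    where
    open ≤-Reasoning
    step : (∃ λ δ → 0ℚ < δ × (q + q) * δ ≡ q * q - x) → ∃ λ p → p < q × 0ℚ < p × x < p * p
    step (δ , 0<δ , dδ≡n) = q - δ , q-δ<q , p<q⇒0<q-p δ<q , (begin-strict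
      x                               <⟨ p<p+q x (0<* 0<δ 0<δ) ⟩
      x + δ * δ                       ≡⟨ solve 3 (λ x q δ → x :+ δ :* δ :=
                                           q :* q :+ :- (q :* q :+ :- x) :+ δ :* δ) refl x q δ ⟩
      q * q - (q * q - x) + δ * δ     ≡⟨ cong (λ n → q * q - n + δ * δ) dδ≡n ⟨
      q * q - (q + q) * δ + δ * δ     ≡⟨ solve 2 (λ q δ → q :* q :+ :- ((q :+ q) :* δ) :+ δ :* δ :=
                                           (q :+ :- δ) :* (q :+ :- δ)) refl q δ ⟩
      (q - δ) * (q - δ)               ∎)
      where
      q-δ<q : q - δ < q
      q-δ<q = subst (q - δ <_) (+-identityʳ q) (+-monoʳ-< q (neg-antimono-< 0<δ))
      δ<q : δ < q
      δ<q = *-cancelˡ-<-nonNeg (q + q) {{nonNegative (<⇒≤ (0<+ 0<q 0<q))}} (begin-strict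
        (q + q) * δ                       ≡⟨ dδ≡n ⟩
        q * q - x                         <⟨ p<p+q (q * q - x) (0<+ (0<* 0<q 0<q) 0<x) ⟩
        (q * q - x) + (q * q + x)         ≡⟨ solve 2 (λ q x → (q :* q :+ :- x) :+ (q :* q :+ x) :=
                                               (q :+ q) :* q) refl q x ⟩
        (q + q) * q                       ∎)

-- The square root of x ≥ 0 (for x < 0 this is the cut of 0).
√_ : ℚ → ℝ
√ x = record
  { L           = Below
  ; U           = Above
  ; L-inhabited = - 1ℚ , inj₁ (negative⁻¹ (- 1ℚ))
  ; U-inhabited = inhabited
  ; L-closed    = L-cl
  ; U-closed    = λ { p<q (0<p , x<pp) →
                      <-trans 0<p p<q , <-trans x<pp (sq-mono-< (<⇒≤ 0<p) p<q) }
  ; L-open      = L-op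
  ; U-open      = λ { (0<q , x<qq) → √-U-open x 0<q x<qq }
  ; disjoint    = λ { (inj₁ q<0)  (0<q , _)  → <-asym q<0 0<q
                    ; (inj₂ qq<x) (_ , x<qq) → <-asym qq<x x<qq }
  ; located     = loc
  }
  where
  Below Above : ℚ → Set
  Below q = q < 0ℚ ⊎ q * q < x
  Above q = 0ℚ < q × x < q * q

  inhabited : ∃ Above
  inhabited with x <? 1ℚ
  ... | yes x<1 = 1ℚ , 0<1 , x<1
  ... | no  x≮1 = x + 1ℚ , 0<x+1 , (begin-strict
    x                    <⟨ p<p+q x 0<1 ⟩
    x + 1ℚ               ≡⟨ *-identityˡ (x + 1ℚ) ⟨
    1ℚ * (x + 1ℚ)        ≤⟨ *-monoʳ-≤-nonNeg (x + 1ℚ) {{nonNegative (<⇒≤ 0<x+1)}} 1≤x+1 ⟩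
    (x + 1ℚ) * (x + 1ℚ)  ∎)
    where
    open ≤-Reasoning
    1≤x+1 : 1ℚ ≤ x + 1ℚ
    1≤x+1 = ≤-trans (≮⇒≥ x≮1) (<⇒≤ (p<p+q x 0<1))
    0<x+1 : 0ℚ < x + 1ℚ
    0<x+1 = <-≤-trans 0<1 1≤x+1

  L-cl : ∀ {p q} → p < q → Below q → Below p
  L-cl         p<q (inj₁ q<0)  = inj₁ (<-trans p<q q<0)
  L-cl {p} {q} p<q (inj₂ qq<x) = by (p <? 0ℚ)
    where
    by : Dec (p < 0ℚ) → Below p
    by (yes p<0) = inj₁ p<0
    by (no  p≮0) = inj₂ (<-trans (sq-mono-< (≮⇒≥ p≮0) p<q) qq<x)

  L-op : ∀ {p} → Below p → ∃ λ q → p < q × Below q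
  L-op {p} b = by (p <? 0ℚ) b
    where
    by : Dec (p < 0ℚ) → Below p → ∃ λ q → p < q × Below q
    by (yes p<0) _           = let q , p<q , q<0 = <-dense p<0 in q , p<q , inj₁ q<0
    by (no  p≮0) (inj₁ p<0)  = contradiction p<0 p≮0
    by (no  p≮0) (inj₂ pp<x) =
      let q , p<q , qq<x = √-L-open x (≮⇒≥ p≮0) pp<x in q , p<q , inj₂ qq<x

  loc : ∀ {p q} → p < q → Below p ⊎ Above q
  loc {p} {q} p<q = by (p <? 0ℚ) (p * p <? x)
    where
    by : Dec (p < 0ℚ) → Dec (p * p < x) → Below p ⊎ Above q
    by (yes p<0) _          = inj₁ (inj₁ p<0)
    by (no  p≮0) (yes pp<x) = inj₁ (inj₂ pp<x)
    by (no  p≮0) (no  pp≮x) = inj₂ (≤-<-trans (≮⇒≥ p≮0) p<q ,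
                                    ≤-<-trans (≮⇒≥ pp≮x) (sq-mono-< (≮⇒≥ p≮0) p<q))

infix  9 √_
infixr 8 _·_
infix  4 _⟶_ _≐_

-- q < c α  ⇔  q / c < α  when c > 0.
_·_ : (c : ℚ) .{{_ : Positive c}} → ℝ → ℝ
c · α = record
  { L           = λ q → L α (q * i)
  ; U           = λ q → U α (q * i)
  ; L-inhabited = let p , Lp = L-inhabited α in c * p , subst (L α) (back p) Lp
  ; U-inhabited = let p , Up = U-inhabited α in c * p , subst (U α) (back p) Up
  ; L-closed    = λ p<q → L-closed α (*-monoˡ-<-pos i p<q)
  ; U-closed    = λ p<q → U-closed α (*-monoˡ-<-pos i p<q)
  ; L-open      = λ {p} Lp → let q , pi<q , Lq = L-open α Lp in
                    c * q , subst (_< c * q) (forth p) (*-monoʳ-<-pos c pi<q) , subst (L α) (back q) Lq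
  ; U-open      = λ {q} Uq → let p , p<qi , Up = U-open α Uq in
                    c * p , subst (c * p <_) (forth q) (*-monoʳ-<-pos c p<qi) , subst (U α) (back p) Up
  ; disjoint    = disjoint α
  ; located     = λ p<q → located α (*-monoˡ-<-pos i p<q)
  }
  where
  open +-*-Solver
  i = recip c
  instance _ = recip-pos c
  back : ∀ p → p ≡ c * p * i
  back p = sym (trans (solve 3 (λ c p i → c :* p :* i := c :* i :* p) refl c p i)
                      (trans (cong (_* p) (*-recip c)) (*-identityˡ p)))
  forth : ∀ p → c * (p * i) ≡ p
  forth p = sym (trans (back p) (*-assoc c p i))

-- |x n - α| < ε, unfolded to  x n - ε < α < x n + ε.
_⟶_ : (ℕ → ℚ) → ℝ → Set
x ⟶ α = ∀ ε → 0ℚ < ε → ∃ λ N → ∀ n → N ℕ.≤ n → L α (x n - ε) × U α (x n + ε)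

-- [c₀,…,cₙ] = c₀ + 1 / [c₁,…,cₙ]
cf : ∀ {n} → Vec ℤ (suc n) → ℚ
cf (c ∷ [])         = c / 1
cf (c ∷ cs@(_ ∷ _)) = c / 1 + recip (cf cs)

Simple : ∀ {n} → Vec ℤ (suc n) → Set
Simple (c ∷ cs) = All ℤ.Positive cs

convergent : (ℕ → ℤ) → ℕ → ℚ
convergent a k = cf (tabulate {n = suc k} (λ i → a (toℕ i)))

-- α = [a₀,a₁,a₂,…], an infinite simple continued fraction
_≐_ : ℝ → (ℕ → ℤ) → Set
α ≐ a = (∀ i → ℤ.Positive (a (suc i))) × convergent a ⟶ α

-- The partial quotients of [b₀,{b₁,…,bₘ,2b₀}]
periodic : ∀ {m} → Vec ℤ (suc m) → ℕ → ℤ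
periodic         (b₀ ∷ bs) zero    = b₀
periodic {m = m} (b₀ ∷ bs) (suc i) = lookup (bs ∷ʳ + 2 ℤ.* b₀) (i ℕ.mod suc m)

-- √x = [b₀,{b₁,…,bₘ,2b₀}] with b₀,…,bₘ ∈ {1,2,3,…}
SqrtExpansion : ℚ → ∀ {m} → Vec ℤ (suc m) → Set
SqrtExpansion x b = All ℤ.Positive b × √ x ≐ periodic b

-- Since ℚ is normalised, the convergent rₖ/sₖ is in lowest terms.
r : (ℕ → ℤ) → ℕ → ℤ
r a k = ↥ convergent a k

s : (ℕ → ℤ) → ℕ → ℕ
s a k = ↧ₙ convergent a k

instance
  pos-/ : ∀ {m n} .{{_ : ℕ.NonZero m}} .{{_ : ℕ.NonZero n}} → Positive (+ m / n)
  pos-/ {m} {n} = normalize-pos m n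

{-# OPTIONS --safe #-}
module Submission where

open import Defs
open import Data.Fin.Base using (Fin; zero; suc; toℕ; fromℕ; inject₁)
open import Data.Fin.Properties using (toℕ-injective; toℕ-fromℕ; toℕ-fromℕ<; toℕ-inject₁; toℕ<n; fromℕ<-cong)
open import Data.Integer.Base as ℤ using (ℤ; +_; +[1+_]; -[1+_]; 0ℤ; 1ℤ)
import Data.Integer.Coprimality as ℤ using (Coprime)
import Data.Integer.Divisibility.Signed as Signed
open import Data.Integer.GCD using (gcd)
import Data.Integer.Properties as ℤ
open import Data.Integer.Tactic.RingSolver using (solve-∀)
open import Data.Nat.Base as ℕ using (ℕ; zero; suc; NonZero; _≤_; _∸_) renaming (_*_ to _*ℕ_)
open import Data.Nat.Coprimality as Coprimality using (Coprime)
open import Data.Nat.Divisibility using (_∣_; quotient; ∣1⇒≡1)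
open import Data.Nat.DivMod using (_%_; _mod_; m%n<n; m<n⇒m%n≡m; [m+kn]%n≡m%n; m≡m%n+[m/n]*n)
import Data.Nat.Properties as ℕ
open import Data.Product.Base using (∃; _×_; _,_; proj₁; proj₂)
open import Data.Rational.Base as ℚ using (ℚ; mkℚ; 0ℚ; 1ℚ; ½; _/_; _<_; _*_; _+_; _-_; -_; ∣_∣; ↥_; ↧_; ↧ₙ_; Positive; positive; nonNegative)
open import Data.Rational.Properties as ℚ using (module ≤-Reasoning)
open import Data.Rational.Solver using (module +-*-Solver)
open import Data.Rational.Unnormalised.Base as ℚᵘ using (mkℚᵘ)
open import Data.Sum.Base using (inj₁; inj₂)
open import Data.Vec.Base using (Vec; []; _∷_; _∷ʳ_; lookup)
open import Data.Vec.Properties using (tabulate-cong; tabulate∘lookup)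
open import Data.Vec.Relation.Unary.All using (All; []; _∷_)
open import Function.Base using (_∘_; case_of_)
open import Relation.Binary.Definitions using (tri<; tri≈; tri>)
open import Relation.Binary.PropositionalEquality using (_≡_; _≢_; refl; sym; trans; cong; cong₂; subst; subst₂; module ≡-Reasoning)
open import Relation.Nullary using (Dec; yes; no; contradiction)
open ℝ

-- Write α = √x with x = D/Q. As α = [b₀,…,bₖ,b₀+α] is irrational, rₖ = sₖ b₀ + sₖ₋₁ and sₖ x = C with
-- C = rₖ b₀ + rₖ₋₁. Put sₖ = d t and let p, t and p⁻, t⁻ be the numerators and denominators of the
-- last two convergents of [c₀,…,cₙ], so that p = rₖ. The parity condition makes the two
-- determinants p sₖ₋₁ - rₖ₋₁ sₖ and p t⁻ - p⁻ t equal, whence p ≡ sₖ₋₁ ≡ t⁻ (mod t); since both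
-- p - c₀ t and t⁻ lie in [1,t] (for n > 0), in fact p = t c₀ + t⁻, and then t d² x = d C = p c₀ + p⁻.
-- Thus d α satisfies the equation of [c₀,{c₁,…,cₙ,2c₀}]. Passing to the convergent one period
-- later multiplies P + Q d α by p + t d α, which has norm ±1; so P² - Q² d² x stays
-- bounded and P / Q tends to d α.

-- Inequalities between integers.

Positives : (ℕ → ℤ) → Set
Positives a = ∀ i → 1ℤ ℤ.≤ a i

1≤⇒0≤ : ∀ {i} → 1ℤ ℤ.≤ i → 0ℤ ℤ.≤ i
1≤⇒0≤ = ℤ.≤-trans (ℤ.+≤+ ℕ.z≤n)

1≤+[1+_] : ∀ n → 1ℤ ℤ.≤ +[1+ n ]
1≤+[1+ n ] = ℤ.+≤+ (ℕ.s≤s ℕ.z≤n)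

0≤*ℤ : ∀ {i j} → 0ℤ ℤ.≤ i → 0ℤ ℤ.≤ j → 0ℤ ℤ.≤ i ℤ.* j
0≤*ℤ {i} {j} 0≤i 0≤j = subst (ℤ._≤ i ℤ.* j) (ℤ.*-zeroʳ i)
  (ℤ.*-monoˡ-≤-nonNeg i {{ℤ.nonNegative 0≤i}} 0≤j)

≤-excess : ∀ {i j} d → 0ℤ ℤ.≤ d → j ≡ i ℤ.+ d → i ℤ.≤ j
≤-excess {i} d 0≤d refl = subst (ℤ._≤ i ℤ.+ d) (ℤ.+-identityʳ i) (ℤ.+-monoʳ-≤ i 0≤d)

i≤j*i : ∀ {i j} → 0ℤ ℤ.≤ i → 1ℤ ℤ.≤ j → i ℤ.≤ j ℤ.* i
i≤j*i {i} {j} 0≤i 1≤j = subst (ℤ._≤ j ℤ.* i) (ℤ.*-identityˡ i)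
  (ℤ.*-monoʳ-≤-nonNeg i {{ℤ.nonNegative 0≤i}} 1≤j)

-- Continuants and their determinants.

-- The product of the matrices (aᵢ 1; 1 0) for i = 0,…,k is (num num⁻; den den⁻), so that
-- num / den is the k-th convergent and num⁻ / den⁻ the one before.
num den num⁻ den⁻ : (ℕ → ℤ) → ℕ → ℤ
num  a zero    = a 0
num  a (suc k) = a 0 ℤ.* num (a ∘ suc) k ℤ.+ den (a ∘ suc) k
den  a zero    = 1ℤ
den  a (suc k) = num (a ∘ suc) k
num⁻ a zero    = 1ℤ
num⁻ a (suc k) = a 0 ℤ.* num⁻ (a ∘ suc) k ℤ.+ den⁻ (a ∘ suc) k
den⁻ a zero    = 0ℤ
den⁻ a (suc k) = num⁻ (a ∘ suc) k

det : (ℕ → ℤ) → ℕ → ℤ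
det a k = num a k ℤ.* den⁻ a k ℤ.- num⁻ a k ℤ.* den a k

-- `sign k` is (-1)^(k+1), not (-1)^k: the determinant of a product of k + 1 matrices, each of
-- determinant -1.
sign : ℕ → ℤ
sign zero    = ℤ.-1ℤ
sign (suc k) = ℤ.- sign k

sign² : ∀ k → sign k ℤ.* sign k ≡ 1ℤ
sign² zero    = refl
sign² (suc k) = trans (lemma (sign k)) (sign² k)
  where
  lemma : ∀ e → ℤ.- e ℤ.* ℤ.- e ≡ e ℤ.* e
  lemma = solve-∀

det≡sign : ∀ a k → det a k ≡ sign k
det≡sign a zero    = lemma (a 0)
  where
  lemma : ∀ x → x ℤ.* 0ℤ ℤ.- 1ℤ ℤ.* 1ℤ ≡ ℤ.-1ℤ
  lemma = solve-∀
det≡sign a (suc k) = trans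
  (lemma (a 0) (num (a ∘ suc) k) (num⁻ (a ∘ suc) k) (den (a ∘ suc) k) (den⁻ (a ∘ suc) k))
  (cong ℤ.-_ (det≡sign (a ∘ suc) k))
  where
  lemma : ∀ x p p⁻ q q⁻ →
    (x ℤ.* p ℤ.+ q) ℤ.* p⁻ ℤ.- (x ℤ.* p⁻ ℤ.+ q⁻) ℤ.* p ≡ ℤ.- (p ℤ.* q⁻ ℤ.- p⁻ ℤ.* q)
  lemma = solve-∀

num-cong : ∀ {a b} → (∀ i → a i ≡ b i) → ∀ k → num a k ≡ num b k
den-cong : ∀ {a b} → (∀ i → a i ≡ b i) → ∀ k → den a k ≡ den b k
num-cong a≡b zero    = a≡b 0
num-cong a≡b (suc k) = cong₂ ℤ._+_
  (cong₂ ℤ._*_ (a≡b 0) (num-cong (a≡b ∘ suc) k)) (den-cong (a≡b ∘ suc) k)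
den-cong a≡b zero    = refl
den-cong a≡b (suc k) = num-cong (a≡b ∘ suc) k

-- The first column of a matrix product split after its first k + 1 factors.
num-++ : ∀ a k N → let b = a ∘ (suc k ℕ.+_) in
  num a (suc k ℕ.+ N) ≡ num a k ℤ.* num b N ℤ.+ num⁻ a k ℤ.* den b N
den-++ : ∀ a k N → let b = a ∘ (suc k ℕ.+_) in
  den a (suc k ℕ.+ N) ≡ den a k ℤ.* num b N ℤ.+ den⁻ a k ℤ.* den b N
num-++ a zero    N = cong (λ z → a 0 ℤ.* num (a ∘ suc) N ℤ.+ z) (sym (ℤ.*-identityˡ _))
num-++ a (suc k) N = trans
  (cong₂ (λ p q → a 0 ℤ.* p ℤ.+ q) (num-++ (a ∘ suc) k N) (den-++ (a ∘ suc) k N))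
  (lemma (a 0) (num (a ∘ suc) k) (num⁻ (a ∘ suc) k) (den (a ∘ suc) k) (den⁻ (a ∘ suc) k) _ _)
  where
  lemma : ∀ x p p⁻ q q⁻ y z →
    x ℤ.* (p ℤ.* y ℤ.+ p⁻ ℤ.* z) ℤ.+ (q ℤ.* y ℤ.+ q⁻ ℤ.* z) ≡
    (x ℤ.* p ℤ.+ q) ℤ.* y ℤ.+ (x ℤ.* p⁻ ℤ.+ q⁻) ℤ.* z
  lemma = solve-∀
den-++ a zero    N = lemma _ (den (a ∘ suc) N)
  where
  lemma : ∀ y z → y ≡ 1ℤ ℤ.* y ℤ.+ 0ℤ ℤ.* z
  lemma = solve-∀
den-++ a (suc k) N = num-++ (a ∘ suc) k N

-- Proved in a single induction: prefixing a term turns the old numerators into the new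
-- denominators, so the bounds on either row feed those on the other.
record Bounds (a : ℕ → ℤ) (k : ℕ) : Set where
  field
    1≤den     : 1ℤ ℤ.≤ den a k
    den≤num   : den a k ℤ.≤ num a k
    0≤den⁻    : 0ℤ ℤ.≤ den⁻ a k
    den⁻≤den  : den⁻ a k ℤ.≤ den a k
    1≤num⁻    : 1ℤ ℤ.≤ num⁻ a k
    num⁻≤num  : num⁻ a k ℤ.≤ num a k

  1≤num : 1ℤ ℤ.≤ num a k
  1≤num = ℤ.≤-trans 1≤den den≤num

open Bounds

bounds : ∀ {a} → Positives a → ∀ k → Bounds a k
bounds pos zero = record
  { 1≤den    = ℤ.≤-refl
  ; den≤num  = pos 0
  ; 0≤den⁻   = ℤ.≤-refl
  ; den⁻≤den = ℤ.+≤+ ℕ.z≤n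
  ; 1≤num⁻   = ℤ.≤-refl
  ; num⁻≤num = pos 0
  }
bounds {a} pos (suc k) = record
  { 1≤den    = 1≤num ih
  ; den≤num  = grow (1≤⇒0≤ (1≤num ih)) (1≤⇒0≤ (1≤den ih))
  ; 0≤den⁻   = 1≤⇒0≤ (1≤num⁻ ih)
  ; den⁻≤den = num⁻≤num ih
  ; 1≤num⁻   = ℤ.≤-trans (1≤num⁻ ih) (grow (1≤⇒0≤ (1≤num⁻ ih)) (0≤den⁻ ih))
  ; num⁻≤num = ℤ.+-mono-≤
      (ℤ.*-monoˡ-≤-nonNeg (a 0) {{ℤ.nonNegative (1≤⇒0≤ (pos 0))}} (num⁻≤num ih)) (den⁻≤den ih)
  }
  where
  ih = bounds (pos ∘ suc) k
  grow : ∀ {p q} → 0ℤ ℤ.≤ p → 0ℤ ℤ.≤ q → p ℤ.≤ a 0 ℤ.* p ℤ.+ q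
  grow {p} {q} 0≤p 0≤q = subst (ℤ._≤ a 0 ℤ.* p ℤ.+ q) (ℤ.+-identityʳ p)
    (ℤ.+-mono-≤ (i≤j*i 0≤p (pos 0)) 0≤q)

num≤ : ∀ {a} → Positives (a ∘ suc) → ∀ k → num a k ℤ.≤ (a 0 ℤ.+ 1ℤ) ℤ.* den a k
num≤ {a} pos zero    = ≤-excess 1ℤ (ℤ.+≤+ ℕ.z≤n) (lemma (a 0))
  where
  lemma : ∀ x → (x ℤ.+ 1ℤ) ℤ.* 1ℤ ≡ x ℤ.+ 1ℤ
  lemma = solve-∀
num≤ {a} pos (suc k) = subst (num a (suc k) ℤ.≤_) (lemma (a 0) _)
  (ℤ.+-monoʳ-≤ (a 0 ℤ.* num (a ∘ suc) k) (den≤num (bounds pos k)))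
  where
  lemma : ∀ x p → x ℤ.* p ℤ.+ p ≡ (x ℤ.+ 1ℤ) ℤ.* p
  lemma = solve-∀

-- Linear growth is enough: through `k≤den` it makes the denominators unbounded, which
-- `null-convergent` relies on.
k<num : ∀ {a} → Positives a → ∀ k → + suc k ℤ.≤ num a k
k<num pos zero    = pos 0
k<num {a} pos (suc k) = subst (ℤ._≤ num a (suc k)) (cong (+_) (ℕ.+-comm (suc k) 1))
  (ℤ.+-mono-≤
    (ℤ.≤-trans (k<num (pos ∘ suc) k) (i≤j*i (1≤⇒0≤ (1≤num ih)) (pos 0)))
    (1≤den ih))
  where ih = bounds (pos ∘ suc) k

k≤den : ∀ {a} → Positives (a ∘ suc) → ∀ k → + k ℤ.≤ den a k
k≤den pos zero    = ℤ.+≤+ ℕ.z≤n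
k≤den pos (suc k) = k<num pos k

-- Shifting by one period.

-- a = [a₀,{a₁,…,aₖ,2a₀}]
Period : (ℕ → ℤ) → ℕ → Set
Period a k = a (suc k) ≡ a 0 ℤ.+ a 0 × (∀ i → a (suc k ℕ.+ suc i) ≡ a (suc i))

module _ {a k} (period : Period a k) where
  private
    b = a ∘ (suc k ℕ.+_)

    head≡ : b 0 ≡ a 0 ℤ.+ a 0
    head≡ = trans (cong a (ℕ.+-identityʳ (suc k))) (proj₁ period)

    -- `b` differs from `a` only in its first term, which is 2 a₀ instead of a₀. Denominators do not
    -- involve that term, and in `num-b` the numerator gains a₀ times the denominator.
    den-b : ∀ N → den b N ≡ den a N
    den-b zero    = refl
    den-b (suc N) = num-cong (proj₂ period) N

    num-b : ∀ N → num b N ≡ num a N ℤ.+ a 0 ℤ.* den a N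
    num-b zero    = trans head≡ (cong (λ z → a 0 ℤ.+ z) (sym (ℤ.*-identityʳ (a 0))))
    num-b (suc N) = trans
      (cong₂ ℤ._+_ (cong₂ ℤ._*_ head≡ (num-cong (proj₂ period) N)) (den-cong (proj₂ period) N))
      (lemma (a 0) _ _)
      where
      lemma : ∀ x p q → (x ℤ.+ x) ℤ.* p ℤ.+ q ≡ x ℤ.* p ℤ.+ q ℤ.+ x ℤ.* p
      lemma = solve-∀

  -- Together with `den-shift`: the column (num; den) is multiplied by the matrix of the first k + 1
  -- terms times (1 a₀; 0 1).
  num-shift : ∀ N → num a (suc k ℕ.+ N) ≡
    num a k ℤ.* num a N ℤ.+ (num a k ℤ.* a 0 ℤ.+ num⁻ a k) ℤ.* den a N
  num-shift N = trans (num-++ a k N) (trans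
    (cong₂ (λ p q → num a k ℤ.* p ℤ.+ num⁻ a k ℤ.* q) (num-b N) (den-b N))
    (lemma (a 0) (num a k) (num⁻ a k) _ _))
    where
    lemma : ∀ x p p⁻ y z →
      p ℤ.* (y ℤ.+ x ℤ.* z) ℤ.+ p⁻ ℤ.* z ≡ p ℤ.* y ℤ.+ (p ℤ.* x ℤ.+ p⁻) ℤ.* z
    lemma = solve-∀

  den-shift : ∀ N → den a (suc k ℕ.+ N) ≡
    den a k ℤ.* num a N ℤ.+ (den a k ℤ.* a 0 ℤ.+ den⁻ a k) ℤ.* den a N
  den-shift N = trans (den-++ a k N) (trans
    (cong₂ (λ p q → den a k ℤ.* p ℤ.+ den⁻ a k ℤ.* q) (num-b N) (den-b N))
    (lemma (a 0) (den a k) (den⁻ a k) _ _))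
    where
    lemma : ∀ x p p⁻ y z →
      p ℤ.* (y ℤ.+ x ℤ.* z) ℤ.+ p⁻ ℤ.* z ≡ p ℤ.* y ℤ.+ (p ℤ.* x ℤ.+ p⁻) ℤ.* z
    lemma = solve-∀

-- Integers inside the rationals, and lowest terms.

ι : ℤ → ℚ
ι z = z / 1

coprime-1 : ∀ n → Coprime n 1
coprime-1 n = Coprimality.sym (Coprimality.1-coprimeTo n)

-- For a variable `z` the normalisation in `z / 1` is stuck; on the explicit `mkℚ` form the rational
-- operations compute.
ι≡ : ∀ z → ι z ≡ mkℚ z 0 (coprime-1 ℤ.∣ z ∣)
ι≡ z = ℚ.↥p/↧p≡p (mkℚ z 0 (coprime-1 ℤ.∣ z ∣))

ι-+ : ∀ i j → ι (i ℤ.+ j) ≡ ι i + ι j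
ι-+ i j = sym (trans (cong₂ _+_ (ι≡ i) (ι≡ j))
  (cong ι (cong₂ ℤ._+_ (ℤ.*-identityʳ i) (ℤ.*-identityʳ j))))

ι-* : ∀ i j → ι (i ℤ.* j) ≡ ι i * ι j
ι-* i j = sym (cong₂ _*_ (ι≡ i) (ι≡ j))

ι-mono-≤ : ∀ {i j} → i ℤ.≤ j → ι i ℚ.≤ ι j
ι-mono-≤ {i} {j} i≤j = subst₂ ℚ._≤_ (sym (ι≡ i)) (sym (ι≡ j))
  (ℚ.*≤* (ℤ.*-monoʳ-≤-nonNeg 1ℤ i≤j))

ι-cancel-≤ : ∀ {i j} → ι i ℚ.≤ ι j → i ℤ.≤ j
ι-cancel-≤ {i} {j} i≤j = ℤ.*-cancelʳ-≤-pos i j 1ℤ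
  (ℚ.drop-*≤* (subst₂ ℚ._≤_ (ι≡ i) (ι≡ j) i≤j))

ι-injective : ∀ {i j} → ι i ≡ ι j → i ≡ j
ι-injective eq = ℤ.≤-antisym (ι-cancel-≤ (ℚ.≤-reflexive eq)) (ι-cancel-≤ (ℚ.≤-reflexive (sym eq)))

ι-neg : ∀ i → ι (ℤ.- i) ≡ - ι i
ι-neg (+ 0)    = refl
ι-neg +[1+ n ] = trans (ι≡ -[1+ n ]) (cong -_ (sym (ι≡ +[1+ n ])))
ι-neg -[1+ n ] = trans (ι≡ +[1+ n ]) (cong -_ (sym (ι≡ -[1+ n ])))

ι-∣∣ : ∀ z → ∣ ι z ∣ ≡ ι (+ ℤ.∣ z ∣)
ι-∣∣ z = trans (cong ∣_∣ (ι≡ z)) (sym (ι≡ (+ ℤ.∣ z ∣)))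

0<ι : ∀ {z} → 1ℤ ℤ.≤ z → 0ℚ < ι z
0<ι 1≤z = ℚ.<-≤-trans 0<1 (ι-mono-≤ 1≤z)

*-cancelʳ : ∀ {p q r} → 0ℚ < r → p * r ≡ q * r → p ≡ q
*-cancelʳ {r = r} 0<r eq = ℚ.≤-antisym
  (ℚ.*-cancelʳ-≤-pos r (ℚ.≤-reflexive eq)) (ℚ.*-cancelʳ-≤-pos r (ℚ.≤-reflexive (sym eq)))
  where instance _ = positive 0<r

p*↧p≡↥p : ∀ p → p * ι (↧ p) ≡ ι (↥ p)
p*↧p≡↥p p@(mkℚ n d _) = trans (cong (p *_) (ι≡ (↧ p)))
  (ℚ.fromℚᵘ-cong {mkℚᵘ (n ℤ.* + suc d) (d *ℕ 1)} {mkℚᵘ n 0} (ℚᵘ.*≡* (lemma n (+ suc d))))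
  where
  lemma : ∀ n d → n ℤ.* d ℤ.* 1ℤ ≡ n ℤ.* (d ℤ.* 1ℤ)
  lemma = solve-∀

n/d*d≡n : ∀ n d .{{_ : NonZero d}} → n / d * ι (+ d) ≡ ι n
n/d*d≡n n d = begin
  y * ι (+ d)          ≡⟨ cong (λ z → y * ι z) (ℚ.↧-/ n d) ⟨
  y * ι (↧ y ℤ.* g)    ≡⟨ cong (y *_) (ι-* (↧ y) g) ⟩
  y * (ι (↧ y) * ι g)  ≡⟨ ℚ.*-assoc y (ι (↧ y)) (ι g) ⟨
  y * ι (↧ y) * ι g    ≡⟨ cong (_* ι g) (p*↧p≡↥p y) ⟩
  ι (↥ y) * ι g        ≡⟨ ι-* (↥ y) g ⟨
  ι (↥ y ℤ.* g)        ≡⟨ cong ι (ℚ.↥-/ n d) ⟩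
  ι n                  ∎
  where
  open ≡-Reasoning
  y = n / d
  g = gcd n (+ d)

-- A common divisor of p and q divides e, hence e² = 1. Squaring treats both signs of the
-- determinant at once.
det⇒coprime : ∀ p p⁻ q q⁻ {e} → p ℤ.* q⁻ ℤ.- p⁻ ℤ.* q ≡ e → e ℤ.* e ≡ 1ℤ → ℤ.Coprime p q
det⇒coprime p p⁻ q q⁻ {e} refl e² {i} (i∣p , i∣q) = ∣1⇒≡1 (Signed.∣⇒∣ᵤ
  (subst (+ i Signed.∣_) e² (Signed.∣m⇒∣m*n e (Signed.∣m∣n⇒∣m-n
    (Signed.∣m⇒∣m*n q⁻ (Signed.∣ᵤ⇒∣ {+ i} {p} i∣p))
    (Signed.∣n⇒∣m*n p⁻ (Signed.∣ᵤ⇒∣ {+ i} {q} i∣q))))))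

-- Cancelling q identifies y with the normal form `mkℚ p d cop`, from which both parts are read off.
lowest-terms : ∀ y {p q} → 1ℤ ℤ.≤ q → ℤ.Coprime p q → y * ι q ≡ ι p → ↥ y ≡ p × ↧ y ≡ q
lowest-terms y {p} {+[1+ d ]} _ cop eq = cong ↥_ y≡ , cong ↧_ y≡
  where
  y≡ : y ≡ mkℚ p d cop
  y≡ = *-cancelʳ (0<ι 1≤+[1+ d ]) (trans eq (sym (p*↧p≡↥p (mkℚ p d cop))))
lowest-terms y {q = + 0}     (ℤ.+≤+ ()) _ _

-- Convergents as quotients of continuants.

convergent>0 : ∀ {a} → Positives a → ∀ k → 0ℚ < convergent a k
convergent>0 pos zero    = 0<ι (pos 0)
convergent>0 {a} pos (suc k) = 0<+ (0<ι (pos 0))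
  (ℚ.positive⁻¹ _ {{recip-pos (convergent (a ∘ suc) k) {{positive (convergent>0 (pos ∘ suc) k)}}}})

convergent*den≡num : ∀ {a} → Positives (a ∘ suc) → ∀ k → convergent a k * ι (den a k) ≡ ι (num a k)
convergent*den≡num {a} pos zero    = ℚ.*-identityʳ _
convergent*den≡num {a} pos (suc k) = begin
  (ι (a 0) + recip y) * ι p            ≡⟨ ℚ.*-distribʳ-+ (ι p) (ι (a 0)) (recip y) ⟩
  ι (a 0) * ι p + recip y * ι p        ≡⟨ cong (λ z → ι (a 0) * ι p + recip y * z) (convergent*den≡num (pos ∘ suc) k) ⟨
  ι (a 0) * ι p + recip y * (y * ι q)  ≡⟨ cong (λ z → ι (a 0) * ι p + z) (solve 3 (λ r y q → r :* (y :* q) := (y :* r) :* q) refl (recip y) y (ι q)) ⟩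
  ι (a 0) * ι p + y * recip y * ι q    ≡⟨ cong (λ z → ι (a 0) * ι p + z * ι q) (*-recip y {{positive (convergent>0 pos k)}}) ⟩
  ι (a 0) * ι p + 1ℚ * ι q             ≡⟨ cong₂ _+_ (sym (ι-* (a 0) p)) (ℚ.*-identityˡ (ι q)) ⟩
  ι (a 0 ℤ.* p) + ι q                  ≡⟨ ι-+ (a 0 ℤ.* p) q ⟨
  ι (a 0 ℤ.* p ℤ.+ q)                  ∎
  where
  open ≡-Reasoning
  open +-*-Solver
  y = convergent (a ∘ suc) k
  p = num (a ∘ suc) k
  q = den (a ∘ suc) k

convergent-lowest-terms : ∀ {a} → Positives (a ∘ suc) → ∀ k →
  r a k ≡ num a k × ↧ convergent a k ≡ den a k
convergent-lowest-terms {a} pos k = lowest-terms (convergent a k) (1≤den′ k)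
  (det⇒coprime (num a k) (num⁻ a k) (den a k) (den⁻ a k) (det≡sign a k) (sign² k))
  (convergent*den≡num pos k)
  where
  -- `a 0` may be any integer here, so `bounds` is applied to the tail, the only part that `den`
  -- sees.
  1≤den′ : ∀ k → 1ℤ ℤ.≤ den a k
  1≤den′ zero    = ℤ.≤-refl
  1≤den′ (suc k) = 1≤num (bounds pos k)

-- Null and bounded sequences of rationals.

∣∣-lub-< : ∀ {p q} → p < q → - p < q → ∣ p ∣ < q
∣∣-lub-< {p} {q} p<q -p<q with ℚ.∣p∣≡p∨∣p∣≡-p p
... | inj₁ eq = subst (_< q) (sym eq) p<q
... | inj₂ eq = subst (_< q) (sym eq) -p<q

-- Limits are handled inside ℚ: a statement about a cut becomes one about a rational sequence
-- tending to 0, which ring identities can rearrange.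
Null : (ℕ → ℚ) → Set
Null u = ∀ ε → 0ℚ < ε → ∃ λ N → ∀ n → N ≤ n → ∣ u n ∣ < ε

-- The bound is strictly positive so that `null-*` can divide by it; this is why 1 is added to ∣ c ∣
-- in `bounded-const` and `bounded-*`.
Bounded : (ℕ → ℚ) → Set
Bounded v = ∃ λ C → 0ℚ < C × (∀ n → ∣ v n ∣ ℚ.≤ C)

null-ext : ∀ {u v} → (∀ n → u n ≡ v n) → Null u → Null v
null-ext u≡v null-u ε 0<ε = let N , small = null-u ε 0<ε in
  N , λ n N≤n → subst (λ z → ∣ z ∣ < ε) (u≡v n) (small n N≤n)

ε½+ε½≡ε : ∀ ε → ε * ½ + ε * ½ ≡ ε
ε½+ε½≡ε ε = trans (sym (ℚ.*-distribˡ-+ ε ½ ½)) (ℚ.*-identityʳ ε)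

0<ε½ : ∀ {ε} → 0ℚ < ε → 0ℚ < ε * ½
0<ε½ 0<ε = 0<* 0<ε (ℚ.positive⁻¹ ½)

null-+ : ∀ {u v} → Null u → Null v → Null (λ n → u n + v n)
null-+ {u} {v} null-u null-v ε 0<ε = M ℕ.⊔ N , λ n M⊔N≤n → begin-strict
  ∣ u n + v n ∣      ≤⟨ ℚ.∣p+q∣≤∣p∣+∣q∣ (u n) (v n) ⟩
  ∣ u n ∣ + ∣ v n ∣  <⟨ ℚ.+-mono-< (small-u n (ℕ.≤-trans (ℕ.m≤m⊔n M N) M⊔N≤n))
                                    (small-v n (ℕ.≤-trans (ℕ.m≤n⊔m M N) M⊔N≤n)) ⟩
  ε * ½ + ε * ½      ≡⟨ ε½+ε½≡ε ε ⟩
  ε                  ∎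
  where
  open ≤-Reasoning
  M = proj₁ (null-u (ε * ½) (0<ε½ 0<ε))
  N = proj₁ (null-v (ε * ½) (0<ε½ 0<ε))
  small-u = proj₂ (null-u (ε * ½) (0<ε½ 0<ε))
  small-v = proj₂ (null-v (ε * ½) (0<ε½ 0<ε))

null-* : ∀ {u v} → Bounded v → Null u → Null (λ n → v n * u n)
null-* {u} {v} (C , 0<C , v≤C) null-u ε 0<ε = by (divide 0<ε 0<C)
  where
  open ≤-Reasoning
  by : (∃ λ δ → 0ℚ < δ × C * δ ≡ ε) → ∃ λ N → ∀ n → N ≤ n → ∣ v n * u n ∣ < ε
  by (δ , 0<δ , Cδ≡ε) = let N , small = null-u δ 0<δ in N , λ n N≤n → begin-strict
    ∣ v n * u n ∣      ≡⟨ ℚ.∣p*q∣≡∣p∣*∣q∣ (v n) (u n) ⟩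
    ∣ v n ∣ * ∣ u n ∣  ≤⟨ ℚ.*-monoʳ-≤-nonNeg ∣ u n ∣ {{nonNegative (ℚ.0≤∣p∣ (u n))}} (v≤C n) ⟩
    C * ∣ u n ∣        <⟨ ℚ.*-monoʳ-<-pos C {{positive 0<C}} (small n N≤n) ⟩
    C * δ              ≡⟨ Cδ≡ε ⟩
    ε                  ∎

-- Otherwise the choice ε = ∣ c ∣ would give ∣ c ∣ < ∣ c ∣.
null-const : ∀ {c} → Null (λ _ → c) → c ≡ 0ℚ
null-const {c} null with ∣ c ∣ ℚ.≟ 0ℚ
... | yes c≡0 = ℚ.∣p∣≡0⇒p≡0 c c≡0
... | no  c≢0 = contradiction (small N ℕ.≤-refl) (ℚ.<-irrefl refl)
  where
  null∣c∣ = null ∣ c ∣ (ℚ.≰⇒> λ c≤0 → c≢0 (ℚ.≤-antisym c≤0 (ℚ.0≤∣p∣ c)))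
  N = proj₁ null∣c∣
  small = proj₂ null∣c∣

bounded-const : ∀ c → Bounded (λ _ → c)
bounded-const c = ∣ c ∣ + 1ℚ , ℚ.+-mono-≤-< (ℚ.0≤∣p∣ c) 0<1 , λ _ → ℚ.<⇒≤ (p<p+q ∣ c ∣ 0<1)

bounded-+ : ∀ {u v} → Bounded u → Bounded v → Bounded (λ n → u n + v n)
bounded-+ {u} {v} (B , 0<B , u≤B) (C , 0<C , v≤C) = B + C , 0<+ 0<B 0<C , λ n →
  ℚ.≤-trans (ℚ.∣p+q∣≤∣p∣+∣q∣ (u n) (v n)) (ℚ.+-mono-≤ (u≤B n) (v≤C n))

bounded-* : ∀ c {u} → Bounded u → Bounded (λ n → c * u n)
bounded-* c {u} (B , 0<B , u≤B) = (∣ c ∣ + 1ℚ) * B , 0<* (ℚ.+-mono-≤-< (ℚ.0≤∣p∣ c) 0<1) 0<B , λ n → begin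
  ∣ c * u n ∣        ≡⟨ ℚ.∣p*q∣≡∣p∣*∣q∣ c (u n) ⟩
  ∣ c ∣ * ∣ u n ∣    ≤⟨ ℚ.*-monoˡ-≤-nonNeg ∣ c ∣ {{nonNegative (ℚ.0≤∣p∣ c)}} (u≤B n) ⟩
  ∣ c ∣ * B          ≤⟨ ℚ.*-monoʳ-≤-nonNeg B {{nonNegative (ℚ.<⇒≤ 0<B)}} (ℚ.<⇒≤ (p<p+q ∣ c ∣ 0<1)) ⟩
  (∣ c ∣ + 1ℚ) * B   ∎
  where open ≤-Reasoning

-- From convergence to null sequences.

L<U : ∀ α {p q} → L α p → U α q → p < q
L<U α {p} {q} Lp Uq with ℚ.<-cmp p q
... | tri< p<q _ _  = p<q
... | tri≈ _ refl _ = contradiction Uq (disjoint α Lp)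
... | tri> _ _ q<p  = contradiction Uq (disjoint α (L-closed α q<p Lp))

-- Both terms lie within ε/2 of α; comparing a lower bound of α from one with an upper bound from
-- the other removes α.
⟶⇒null-shift : ∀ {y α} → y ⟶ α → ∀ K → Null (λ n → y (K ℕ.+ n) - y n)
⟶⇒null-shift {y} {α} y⟶α K ε 0<ε = N , λ n N≤n →
  let y-δ<α  , α<y+δ  = near n N≤n
      y′-δ<α , α<y′+δ = near (K ℕ.+ n) (ℕ.≤-trans N≤n (ℕ.m≤n+m n K))
  in ∣∣-lub-< (apart (y (K ℕ.+ n)) (y n) (L<U α y′-δ<α α<y+δ))
              (subst (_< ε) (swap (y n) (y (K ℕ.+ n))) (apart (y n) (y (K ℕ.+ n)) (L<U α y-δ<α α<y′+δ)))
  where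
  open +-*-Solver
  δ = ε * ½
  N = proj₁ (y⟶α δ (0<ε½ 0<ε))
  near = proj₂ (y⟶α δ (0<ε½ 0<ε))
  swap : ∀ a b → a - b ≡ - (b - a)
  swap = solve 2 (λ a b → a :+ :- b := :- (b :+ :- a)) refl
  apart : ∀ a b → a - δ < b + δ → a - b < ε
  apart a b lt = subst₂ _<_
    (solve 3 (λ a b δ → a :+ :- δ :+ (δ :+ :- b) := a :+ :- b) refl a b δ)
    (trans (solve 3 (λ a b δ → b :+ δ :+ (δ :+ :- b) := δ :+ δ) refl a b δ) (ε½+ε½≡ε ε))
    (ℚ.+-monoˡ-< (δ - b) lt)

-- From y - ε < √x < y + ε and y > 0, both y² - x and its negative are below (2y + ε) ε.
⟶√⇒null : ∀ {y x B} → (∀ n → 0ℚ < y n) → (∀ n → y n ℚ.≤ B) → 0ℚ < x → y ⟶ √ x →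
  Null (λ n → y n * y n - x)
⟶√⇒null {y} {x} {B} 0<y y≤B 0<x y⟶√x η 0<η = by (divide 0<η 0<d)
  where
  open ≤-Reasoning
  open +-*-Solver
  0<B : 0ℚ < B
  0<B = ℚ.<-≤-trans (0<y 0) (y≤B 0)
  -- With ε = η / d, the summand η ensures ε ≤ 1, and the rest ensures (2B + 1) ε ≤ η.
  d = (B + B + 1ℚ) + η
  0<d : 0ℚ < d
  0<d = 0<+ (0<+ (0<+ 0<B 0<B) 0<1) 0<η
  by : (∃ λ ε → 0ℚ < ε × d * ε ≡ η) → ∃ λ N → ∀ n → N ≤ n → ∣ y n * y n - x ∣ < η
  by (ε , 0<ε , dε≡η) = N , λ n N≤n → let y-ε<√x , 0<y+ε , x<[y+ε]² = near n N≤n in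
    ∣∣-lub-< (ℚ.<-≤-trans (lower n y-ε<√x) (small n))
             (ℚ.<-≤-trans (upper n x<[y+ε]²) (small n))
    where
    N = proj₁ (y⟶√x ε 0<ε)
    near = proj₂ (y⟶√x ε 0<ε)
    ε≤1 : ε ℚ.≤ 1ℚ
    ε≤1 = ℚ.*-cancelˡ-≤-pos d {{positive 0<d}} (begin
      d * ε   ≡⟨ dε≡η ⟩
      η       ≡⟨ ℚ.+-identityˡ η ⟨
      0ℚ + η  ≤⟨ ℚ.+-monoˡ-≤ η (ℚ.<⇒≤ (0<+ (0<+ 0<B 0<B) 0<1)) ⟩
      d       ≡⟨ ℚ.*-identityʳ d ⟨
      d * 1ℚ  ∎)
    small : ∀ n → (y n + y n + ε) * ε ℚ.≤ η
    small n = begin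
      (y n + y n + ε) * ε  ≤⟨ ℚ.*-monoʳ-≤-nonNeg ε {{nonNegative (ℚ.<⇒≤ 0<ε)}}
                                (ℚ.+-mono-≤ (ℚ.+-mono-≤ (y≤B n) (y≤B n)) ε≤1) ⟩
      (B + B + 1ℚ) * ε     ≤⟨ ℚ.*-monoʳ-≤-nonNeg ε {{nonNegative (ℚ.<⇒≤ 0<ε)}}
                                (ℚ.<⇒≤ (p<p+q (B + B + 1ℚ) 0<η)) ⟩
      d * ε                ≡⟨ dε≡η ⟩
      η                    ∎
    upper : ∀ n → x < (y n + ε) * (y n + ε) → - (y n * y n - x) < (y n + y n + ε) * ε
    upper n lt = subst₂ _<_
      (solve 2 (λ x y → x :+ :- (y :* y) := :- (y :* y :+ :- x)) refl x (y n))
      (solve 2 (λ y ε → (y :+ ε) :* (y :+ ε) :+ :- (y :* y) := (y :+ y :+ ε) :* ε) refl (y n) ε)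
      (ℚ.+-monoˡ-< (- (y n * y n)) lt)
    lower : ∀ n → L (√ x) (y n - ε) → y n * y n - x < (y n + y n + ε) * ε
    -- When y - ε is negative, lying below √x says nothing about its square; but then y < ε, so y² <
    -- y ε.
    lower n (inj₁ y-ε<0) = begin-strict
      y n * y n - x                        <⟨ ℚ.+-monoʳ-< (y n * y n) (ℚ.neg-antimono-< 0<x) ⟩
      y n * y n + 0ℚ                       ≡⟨ ℚ.+-identityʳ (y n * y n) ⟩
      y n * y n                            <⟨ ℚ.*-monoʳ-<-pos (y n) {{positive (0<y n)}} y<ε ⟩
      y n * ε                              <⟨ p<p+q (y n * ε) (0<* (0<+ (0<y n) 0<ε) 0<ε) ⟩
      y n * ε + (y n + ε) * ε              ≡⟨ solve 2 (λ y ε → y :* ε :+ (y :+ ε) :* ε := (y :+ y :+ ε) :* ε) refl (y n) ε ⟩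
      (y n + y n + ε) * ε                  ∎
      where
      y<ε : y n < ε
      y<ε = subst₂ _<_ (solve 2 (λ y ε → y :+ :- ε :+ ε := y) refl (y n) ε) (ℚ.+-identityˡ ε)
        (ℚ.+-monoˡ-< ε y-ε<0)
    lower n (inj₂ lt) = begin-strict
      y n * y n - x                        ≡⟨ solve 3 (λ y ε x → y :* y :+ :- x :=
                                                (y :+ :- ε) :* (y :+ :- ε) :+ (:- x :+ ((y :+ y) :* ε :+ :- (ε :* ε)))) refl (y n) ε x ⟩
      (y n - ε) * (y n - ε) + e            <⟨ ℚ.+-monoˡ-< e lt ⟩
      x + e                                <⟨ p<p+q (x + e) (0<+ (0<* 0<ε 0<ε) (0<* 0<ε 0<ε)) ⟩
      x + e + (ε * ε + ε * ε)              ≡⟨ solve 3 (λ y ε x → x :+ (:- x :+ ((y :+ y) :* ε :+ :- (ε :* ε))) :+ (ε :* ε :+ ε :* ε)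
                                                := (y :+ y :+ ε) :* ε) refl (y n) ε x ⟩
      (y n + y n + ε) * ε                  ∎
      where e = - x + ((y n + y n) * ε - ε * ε)

-- The equations that periodicity imposes on √x.

module _ {a} (pos : Positives a) where
  private y = convergent a

  convergent≤ : ∀ k → y k ℚ.≤ ι (a 0 ℤ.+ 1ℤ)
  convergent≤ k = ℚ.*-cancelʳ-≤-pos (ι (den a k)) {{positive (0<ι (1≤den (bounds pos k)))}}
    (subst₂ ℚ._≤_ (sym (convergent*den≡num (pos ∘ suc) k)) (ι-* (a 0 ℤ.+ 1ℤ) (den a k))
      (ι-mono-≤ (num≤ (pos ∘ suc) k)))

  1≤convergent : ∀ k → 1ℚ ℚ.≤ y k
  1≤convergent k = ℚ.*-cancelʳ-≤-pos (ι (den a k)) {{positive (0<ι (1≤den (bounds pos k)))}}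
    (subst₂ ℚ._≤_ (sym (ℚ.*-identityˡ _)) (sym (convergent*den≡num (pos ∘ suc) k))
      (ι-mono-≤ (den≤num (bounds pos k))))

  bounded-convergent : Bounded y
  bounded-convergent = ι (a 0 ℤ.+ 1ℤ) , ℚ.<-≤-trans (convergent>0 pos 0) (convergent≤ 0) , λ k →
    subst (ℚ._≤ ι (a 0 ℤ.+ 1ℤ)) (sym (ℚ.0≤p⇒∣p∣≡p (ℚ.<⇒≤ (convergent>0 pos k)))) (convergent≤ k)

  module _ {k} (period : Period a k) where
    private
      t  = ι (den a k)
      t′ = ι (den a k ℤ.* a 0 ℤ.+ den⁻ a k)
      p  = ι (num a k)
      p′ = ι (num a k ℤ.* a 0 ℤ.+ num⁻ a k)

      ι-lin : ∀ i j m n → ι (i ℤ.* j ℤ.+ m ℤ.* n) ≡ ι i * ι j + ι m * ι n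
      ι-lin i j m n = trans (ι-+ (i ℤ.* j) (m ℤ.* n)) (cong₂ _+_ (ι-* i j) (ι-* m n))

    -- One period acts on the convergents as the Möbius map z ↦ (p z + p′) / (t z + t′), here
    -- cleared of its denominator.
    convergent-shift : ∀ n → y (suc k ℕ.+ n) * (t * y n + t′) ≡ p * y n + p′
    convergent-shift n = *-cancelʳ (0<ι (1≤den (bounds pos n))) (begin
      y′ * (t * y n + t′) * Q       ≡⟨ solve 5 (λ y′ t t′ y Q → y′ :* (t :* y :+ t′) :* Q := y′ :* (t :* (y :* Q) :+ t′ :* Q)) refl y′ t t′ (y n) Q ⟩
      y′ * (t * (y n * Q) + t′ * Q) ≡⟨ cong (λ z → y′ * (t * z + t′ * Q)) (convergent*den≡num (pos ∘ suc) n) ⟩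
      y′ * (t * P + t′ * Q)         ≡⟨ cong (y′ *_) (trans (cong ι (den-shift {a} {k} period n)) (ι-lin (den a k) (num a n) (den a k ℤ.* a 0 ℤ.+ den⁻ a k) (den a n))) ⟨
      y′ * ι (den a (suc k ℕ.+ n))  ≡⟨ convergent*den≡num {a} (pos ∘ suc) (suc k ℕ.+ n) ⟩
      ι (num a (suc k ℕ.+ n))       ≡⟨ trans (cong ι (num-shift {a} {k} period n)) (ι-lin (num a k) (num a n) (num a k ℤ.* a 0 ℤ.+ num⁻ a k) (den a n)) ⟩
      p * P + p′ * Q                ≡⟨ cong (λ z → p * z + p′ * Q) (convergent*den≡num (pos ∘ suc) n) ⟨
      p * (y n * Q) + p′ * Q        ≡⟨ solve 4 (λ p p′ y Q → p :* (y :* Q) :+ p′ :* Q := (p :* y :+ p′) :* Q) refl p p′ (y n) Q ⟩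
      (p * y n + p′) * Q            ∎)
      where
      open ≡-Reasoning
      open +-*-Solver
      y′ = y (suc k ℕ.+ n)
      P = ι (num a n)
      Q = ι (den a n)

    -- In the limit √x is a root of t z² + t′ z = p z + p′; being irrational, it forces t′ = p.
    period-equations : ∀ {x} → 0ℚ < x → (∀ z → z * z ≢ x) → y ⟶ √ x →
      num a k ≡ den a k ℤ.* a 0 ℤ.+ den⁻ a k ×
      ι (den a k) * x ≡ ι (num a k ℤ.* a 0 ℤ.+ num⁻ a k)
    period-equations {x} 0<x irrational y⟶√x = sym (ι-injective t′≡p) , -≡0⇒≡ E≡0
      where
      open +-*-Solver
      -≡0⇒≡ : ∀ {p q} → p - q ≡ 0ℚ → p ≡ q
      -≡0⇒≡ {p} {q} eq = trans (solve 2 (λ p q → p := p :+ :- q :+ q) refl p q)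
        (trans (cong (_+ q) eq) (ℚ.+-identityˡ q))
      B = t′ - p
      E = t * x - p′
      null-y²-x : Null (λ n → y n * y n - x)
      null-y²-x = ⟶√⇒null {y} (convergent>0 pos) convergent≤ 0<x y⟶√x
      -- Write y′ for y one period later. Up to the null sequences y′ - y and y² - x, the product y′
      -- (t y + t′) is t x + t′ y, whereas `convergent-shift` makes it p y + p′; the difference of
      -- the two is B y + E.
      null-By+E : Null (λ n → B * y n + E)
      null-By+E = null-ext
        {u = λ n → (- t * y n + - t′) * (y (suc k ℕ.+ n) - y n) + - t * (y n * y n - x)} eq
        (null-+
          (null-* (bounded-+ (bounded-* (- t) bounded-convergent) (bounded-const (- t′)))
            (⟶⇒null-shift {y} {√ x} y⟶√x (suc k)))
          (null-* (bounded-const (- t)) null-y²-x))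
        where
        eq : ∀ n → (- t * y n + - t′) * (y (suc k ℕ.+ n) - y n) + - t * (y n * y n - x) ≡ B * y n + E
        eq n = trans
          (solve 5 (λ t t′ y y′ x → (:- t :* y :+ :- t′) :* (y′ :+ :- y) :+ :- t :* (y :* y :+ :- x)
            := t′ :* y :+ t :* x :+ :- (y′ :* (t :* y :+ t′))) refl t t′ (y n) (y (suc k ℕ.+ n)) x)
          (trans (cong (λ z → t′ * y n + t * x - z) (convergent-shift n))
          (solve 6 (λ t t′ p p′ y x → t′ :* y :+ t :* x :+ :- (p :* y :+ p′)
            := (t′ :+ :- p) :* y :+ (t :* x :+ :- p′)) refl t t′ p p′ (y n) x))
      -- The sequence (B y - E)(B y + E) - B² (y² - x) is null, and it is constantly B² x - E².
      B²x≡E² : B * B * x ≡ E * E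
      B²x≡E² = -≡0⇒≡ (null-const (null-ext
        {u = λ n → (B * y n + - E) * (B * y n + E) + - (B * B) * (y n * y n - x)}
        (λ n → solve 4 (λ B E y x → (B :* y :+ :- E) :* (B :* y :+ E) :+ :- (B :* B) :* (y :* y :+ :- x)
          := B :* B :* x :+ :- (E :* E)) refl B E (y n) x)
        (null-+
          (null-* (bounded-+ (bounded-* B bounded-convergent) (bounded-const (- E))) null-By+E)
          (null-* (bounded-const (- (B * B))) null-y²-x))))
      -- Otherwise E / B would be a rational square root of x.
      B≡0 : B ≡ 0ℚ
      B≡0 with B ℚ.≟ 0ℚ
      ... | yes eq = eq
      ... | no B≢0 = contradiction root (irrational (E * b))
        where
        instance _ = ℚ.≢-nonZero B≢0
        b = ℚ.1/ B
        root : E * b * (E * b) ≡ x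
        root = begin
          E * b * (E * b)        ≡⟨ solve 2 (λ E b → E :* b :* (E :* b) := E :* E :* (b :* b)) refl E b ⟩
          E * E * (b * b)        ≡⟨ cong (_* (b * b)) B²x≡E² ⟨
          B * B * x * (b * b)    ≡⟨ solve 3 (λ B b x → B :* B :* x :* (b :* b) := B :* b :* (B :* b :* x)) refl B b x ⟩
          B * b * (B * b * x)    ≡⟨ cong (λ z → z * (z * x)) (ℚ.*-inverseʳ B) ⟩
          1ℚ * (1ℚ * x)          ≡⟨ trans (ℚ.*-identityˡ _) (ℚ.*-identityˡ x) ⟩
          x                      ∎
          where open ≡-Reasoning
      t′≡p : t′ ≡ p
      t′≡p = -≡0⇒≡ B≡0
      E≡0 : E ≡ 0ℚ
      E≡0 = null-const (null-ext
        (λ n → trans (cong (λ z → z * y n + E) B≡0) (trans (cong (_+ E) (ℚ.*-zeroˡ (y n))) (ℚ.+-identityˡ E)))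
        null-By+E)

-- Convergence to a multiple of a square root.

p≤∣p∣ : ∀ p → p ℚ.≤ ∣ p ∣
p≤∣p∣ p with ℚ.≤-total 0ℚ p
... | inj₁ 0≤p = ℚ.≤-reflexive (sym (ℚ.0≤p⇒∣p∣≡p 0≤p))
... | inj₂ p≤0 = ℚ.≤-trans p≤0 (ℚ.0≤∣p∣ p)

-- As y ≥ 1, moving y by ε moves its square by at least ε, provided the result stays nonnegative.
-- Hence the index that serves ε in the hypothesis serves the same ε in the conclusion.
null⇒⟶√ : ∀ {y} w x .{{_ : Positive w}} → (∀ n → 1ℚ ℚ.≤ y n) →
  Null (λ n → y n * y n - w * w * x) → y ⟶ w · √ x
null⇒⟶√ {y} w x 1≤y null ε 0<ε = N , λ n N≤n →
  below n (ℚ.≤-<-trans (p≤∣p∣ (y n * y n - X)) (near n N≤n)) ((y n - ε) ℚ.<? 0ℚ) ,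
  0<* (0<y+ε n) 0<i ,
  above n (ℚ.≤-<-trans (p≤∣p∣ (- (y n * y n - X)))
    (subst (_< ε) (sym (ℚ.∣-p∣≡∣p∣ (y n * y n - X))) (near n N≤n)))
  where
  open ≤-Reasoning
  open +-*-Solver
  N = proj₁ (null ε 0<ε)
  near = proj₂ (null ε 0<ε)
  X = w * w * x
  i = recip w
  0<i : 0ℚ < i
  0<i = ℚ.positive⁻¹ i {{recip-pos w}}
  0<i² : 0ℚ < i * i
  0<i² = 0<* 0<i 0<i
  0<y+ε : ∀ n → 0ℚ < y n + ε
  0<y+ε n = 0<+ (ℚ.<-≤-trans 0<1 (1≤y n)) 0<ε
  X/w² : X * (i * i) ≡ x
  X/w² = begin-equality
    w * w * x * (i * i)  ≡⟨ solve 3 (λ w x i → w :* w :* x :* (i :* i) := w :* i :* (w :* i :* x)) refl w x i ⟩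
    w * i * (w * i * x)  ≡⟨ cong (λ u → u * (u * x)) (*-recip w) ⟩
    1ℚ * (1ℚ * x)        ≡⟨ trans (ℚ.*-identityˡ (1ℚ * x)) (ℚ.*-identityˡ x) ⟩
    x                    ∎
  scale : ∀ z → z * z * (i * i) ≡ z * i * (z * i)
  scale z = solve 2 (λ z i → z :* z :* (i :* i) := z :* i :* (z :* i)) refl z i
  below : ∀ n → y n * y n - X < ε → Dec (y n - ε < 0ℚ) → L (w · √ x) (y n - ε)
  -- The lower cut of a square root contains every negative rational.
  below n _  (yes y-ε<0) = inj₁ (subst ((y n - ε) * i <_) (ℚ.*-zeroˡ i) (ℚ.*-monoˡ-<-pos i {{positive 0<i}} y-ε<0))
  below n lt (no  y-ε≮0) = inj₂ (subst₂ _<_ (scale z) X/w² (ℚ.*-monoˡ-<-pos (i * i) {{positive 0<i²}} (begin-strict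
    z * z                    ≡⟨ solve 2 (λ y ε → (y :+ :- ε) :* (y :+ :- ε) := y :* y :+ :- (ε :* (y :+ (y :+ :- ε)))) refl (y n) ε ⟩
    y n * y n - ε * (y n + z) ≤⟨ ℚ.+-monoʳ-≤ (y n * y n) (ℚ.neg-antimono-≤ ε≤) ⟩
    y n * y n - ε            ≡⟨ solve 3 (λ y ε X → y :* y :+ :- ε := y :* y :+ :- X :+ (X :+ :- ε)) refl (y n) ε X ⟩
    y n * y n - X + (X - ε)  <⟨ ℚ.+-monoˡ-< (X - ε) lt ⟩
    ε + (X - ε)              ≡⟨ solve 2 (λ ε X → ε :+ (X :+ :- ε) := X) refl ε X ⟩
    X                        ∎)))
    where
    z = y n - ε
    ε≤ : ε ℚ.≤ ε * (y n + z)
    ε≤ = subst (ℚ._≤ ε * (y n + z)) (ℚ.*-identityʳ ε)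
      (ℚ.*-monoˡ-≤-nonNeg ε {{nonNegative (ℚ.<⇒≤ 0<ε)}}
        (ℚ.+-mono-≤ (1≤y n) (ℚ.≮⇒≥ y-ε≮0)))
  above : ∀ n → - (y n * y n - X) < ε → x < (y n + ε) * i * ((y n + ε) * i)
  above n lt = subst₂ _<_ X/w² (scale z) (ℚ.*-monoˡ-<-pos (i * i) {{positive 0<i²}} (begin-strict
    X                                ≡⟨ solve 2 (λ y X → X := :- (y :* y :+ :- X) :+ y :* y) refl (y n) X ⟩
    - (y n * y n - X) + y n * y n    <⟨ ℚ.+-monoˡ-< (y n * y n) lt ⟩
    ε + y n * y n                    ≤⟨ ℚ.+-monoˡ-≤ (y n * y n) ε≤ ⟩
    ε * (y n + z) + y n * y n        ≡⟨ solve 2 (λ y ε → ε :* (y :+ (y :+ ε)) :+ y :* y := (y :+ ε) :* (y :+ ε)) refl (y n) ε ⟩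
    z * z                            ∎))
    where
    z = y n + ε
    ε≤ : ε ℚ.≤ ε * (y n + z)
    ε≤ = subst (ℚ._≤ ε * (y n + z)) (ℚ.*-identityʳ ε)
      (ℚ.*-monoˡ-≤-nonNeg ε {{nonNegative (ℚ.<⇒≤ 0<ε)}}
        (ℚ.+-mono-≤ (1≤y n) (ℚ.<⇒≤ (0<y+ε n))))

-- The Archimedean property and bounds from periodicity.

-- Multiplying ε by its denominator leaves a numerator of at least 1, so N = (C + 1) times that
-- denominator gives ε N ≥ C + 1.
archimedean : ∀ ε → 0ℚ < ε → ∀ C → ∃ λ N → ι (+ C) < ε * ι (+ N)
archimedean ε@(mkℚ +[1+ e ] _ _) _ C = ↧ₙ ε *ℕ suc C , (begin-strict
  ι (+ C)                        <⟨ p<p+q (ι (+ C)) 0<1 ⟩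
  ι (+ C) + 1ℚ                   ≡⟨ ι-+ (+ C) 1ℤ ⟨
  ι (+ C ℤ.+ 1ℤ)                 ≡⟨ cong (ι ∘ +_) (ℕ.+-comm C 1) ⟩
  ι +[1+ C ]                     ≤⟨ ι-mono-≤ {+[1+ C ]} (i≤j*i (ℤ.+≤+ ℕ.z≤n) 1≤+[1+ e ]) ⟩
  ι (↥ ε ℤ.* +[1+ C ])           ≡⟨ ι-* (↥ ε) +[1+ C ] ⟩
  ι (↥ ε) * ι +[1+ C ]           ≡⟨ cong (_* ι +[1+ C ]) (p*↧p≡↥p ε) ⟨
  ε * ι (↧ ε) * ι +[1+ C ]       ≡⟨ ℚ.*-assoc ε (ι (↧ ε)) (ι +[1+ C ]) ⟩
  ε * (ι (↧ ε) * ι +[1+ C ])     ≡⟨ cong (ε *_) (ι-* (↧ ε) +[1+ C ]) ⟨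
  ε * ι (↧ ε ℤ.* +[1+ C ])       ≡⟨ cong (λ z → ε * ι z) (ℤ.pos-* (↧ₙ ε) (suc C)) ⟨
  ε * ι (+ (↧ₙ ε *ℕ suc C))      ∎)
  where open ≤-Reasoning
archimedean (mkℚ (+ 0)    _ _) (ℚ.*<* (ℤ.+<+ ()))
archimedean (mkℚ -[1+ _ ] _ _) (ℚ.*<* ())

bounded-below : ∀ (f : ℕ → ℕ) K → ∃ λ C → ∀ n → n ℕ.< K → f n ≤ C
bounded-below f zero    = 0 , λ _ ()
bounded-below f (suc K) = let C , f≤C = bounded-below f K in
  f K ℕ.⊔ C , λ n n<1+K → case ℕ.m<1+n⇒m<n∨m≡n n<1+K of λ where
    (inj₁ n<K)  → ℕ.≤-trans (f≤C n n<K) (ℕ.m≤n⊔m (f K) C)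
    (inj₂ refl) → ℕ.m≤m⊔n (f K) C

-- Reducing the index modulo `suc k` leaves finitely many values.
periodic⇒bounded : ∀ (f : ℕ → ℕ) k → (∀ n → f (suc k ℕ.+ n) ≡ f n) → ∃ λ C → ∀ n → f n ≤ C
periodic⇒bounded f k f-periodic = let C , f≤C = bounded-below f (suc k) in
  C , λ n → subst (_≤ C) (sym (f-mod n)) (f≤C (n % suc k) (m%n<n n (suc k)))
  where
  f-periods : ∀ q j → f (q *ℕ suc k ℕ.+ j) ≡ f j
  f-periods zero    j = refl
  f-periods (suc q) j = trans (cong f (ℕ.+-assoc (suc k) (q *ℕ suc k) j))
    (trans (f-periodic (q *ℕ suc k ℕ.+ j)) (f-periods q j))
  f-mod : ∀ n → f n ≡ f (n % suc k)
  f-mod n = trans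
    (cong f (trans (m≡m%n+[m/n]*n n (suc k)) (ℕ.+-comm (n % suc k) (n ℕ./ suc k *ℕ suc k))))
    (f-periods (n ℕ./ suc k) (n % suc k))

-- Convergence deduced from the bounded norm form.

module _ {a} (pos : Positives a) {k} (period : Period a k)
  (num≡ : num a k ≡ den a k ℤ.* a 0 ℤ.+ den⁻ a k)
  where
  private
    y = convergent a
    p = num a k
    t = den a k
    E = num a k ℤ.* a 0 ℤ.+ num⁻ a k

    -- This is t q² (y² - E / t), where y is the convergent and q its denominator.
    form : ℕ → ℤ
    form n = t ℤ.* (num a n ℤ.* num a n) ℤ.- E ℤ.* (den a n ℤ.* den a n)

    -- By `num≡` the matrix of `num-shift` and `den-shift` is (p E; t p). It differs from the matrix
    -- of the first k + 1 terms by a factor of determinant 1, so its determinant is `det a k`.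
    norm : p ℤ.* p ℤ.- t ℤ.* E ≡ sign k
    norm = trans (cong (λ z → z ℤ.* z ℤ.- t ℤ.* (z ℤ.* a 0 ℤ.+ num⁻ a k)) num≡)
      (trans (lemma t (a 0) (num⁻ a k) (den⁻ a k))
      (trans (cong (λ z → z ℤ.* den⁻ a k ℤ.- num⁻ a k ℤ.* t) (sym num≡)) (det≡sign a k)))
      where
      lemma : ∀ t x p⁻ q⁻ → let p = t ℤ.* x ℤ.+ q⁻ in
        p ℤ.* p ℤ.- t ℤ.* (p ℤ.* x ℤ.+ p⁻) ≡ p ℤ.* q⁻ ℤ.- p⁻ ℤ.* t
      lemma = solve-∀

    -- (num, den) ↦ (p num + E den, t num + p den) multiplies num √t + den √E by p + √(t E).
    form-shift : ∀ n → form (suc k ℕ.+ n) ≡ sign k ℤ.* form n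
    form-shift n = trans
      (cong₂ (λ u v → t ℤ.* (u ℤ.* u) ℤ.- E ℤ.* (v ℤ.* v))
        (num-shift {a} {k} period n)
        (trans (den-shift {a} {k} period n)
          (cong (λ z → t ℤ.* num a n ℤ.+ z ℤ.* den a n) (sym num≡))))
      (trans (lemma p t E (num a n) (den a n)) (cong (ℤ._* form n) norm))
      where
      lemma : ∀ p t E u v →
        t ℤ.* ((p ℤ.* u ℤ.+ E ℤ.* v) ℤ.* (p ℤ.* u ℤ.+ E ℤ.* v)) ℤ.-
        E ℤ.* ((t ℤ.* u ℤ.+ p ℤ.* v) ℤ.* (t ℤ.* u ℤ.+ p ℤ.* v)) ≡
        (p ℤ.* p ℤ.- t ℤ.* E) ℤ.* (t ℤ.* (u ℤ.* u) ℤ.- E ℤ.* (v ℤ.* v))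
      lemma = solve-∀

    ∣sign∣ : ∀ k → ℤ.∣ sign k ∣ ≡ 1
    ∣sign∣ zero    = refl
    ∣sign∣ (suc k) = trans (ℤ.∣-i∣≡∣i∣ (sign k)) (∣sign∣ k)

    ∣form∣-bounded : ∃ λ C → ∀ n → ℤ.∣ form n ∣ ≤ C
    ∣form∣-bounded = periodic⇒bounded (λ n → ℤ.∣ form n ∣) k λ n → begin
      ℤ.∣ form (suc k ℕ.+ n) ∣         ≡⟨ cong ℤ.∣_∣ (form-shift n) ⟩
      ℤ.∣ sign k ℤ.* form n ∣          ≡⟨ ℤ.∣i*j∣≡∣i∣*∣j∣ (sign k) (form n) ⟩
      ℤ.∣ sign k ∣ *ℕ ℤ.∣ form n ∣     ≡⟨ cong (_*ℕ ℤ.∣ form n ∣) (∣sign∣ k) ⟩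
      1 *ℕ ℤ.∣ form n ∣                ≡⟨ ℕ.*-identityˡ ℤ.∣ form n ∣ ⟩
      ℤ.∣ form n ∣                     ∎
      where open ≡-Reasoning

  -- ∣ y² - X ∣ is ∣ `form n` ∣ / (t q²), with bounded numerator and with t q² ≥ n. A value of at
  -- least ε from N on would contradict C < ε N.
  null-convergent : ∀ {X} → ι t * X ≡ ι E → Null (λ n → y n * y n - X)
  null-convergent {X} tX≡E ε 0<ε = N , λ n N≤n → ℚ.≰⇒> λ ε≤∣u∣ → ℚ.<-irrefl refl (begin-strict
    ι (+ C)                           <⟨ C<εN ⟩
    ε * ι (+ N)                       ≤⟨ ℚ.*-monoˡ-≤-nonNeg ε {{nonNegative (ℚ.<⇒≤ 0<ε)}}
                                           (ι-mono-≤ (ℤ.≤-trans (ℤ.+≤+ N≤n) (n≤tq² n))) ⟩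
    ε * ι (tq² n)                     ≤⟨ ℚ.*-monoʳ-≤-nonNeg (ι (tq² n))
                                           {{nonNegative (ι-mono-≤ (ℤ.≤-trans (ℤ.+≤+ ℕ.z≤n) (n≤tq² n)))}} ε≤∣u∣ ⟩
    ∣ u n ∣ * ι (tq² n)               ≡⟨ cong (∣ u n ∣ *_) (ℚ.0≤p⇒∣p∣≡p (ι-mono-≤ (ℤ.≤-trans (ℤ.+≤+ ℕ.z≤n) (n≤tq² n)))) ⟨
    ∣ u n ∣ * ∣ ι (tq² n) ∣           ≡⟨ ℚ.∣p*q∣≡∣p∣*∣q∣ (u n) (ι (tq² n)) ⟨
    ∣ u n * ι (tq² n) ∣               ≡⟨ cong ∣_∣ (u*tq²≡form n) ⟩
    ∣ ι (form n) ∣                    ≡⟨ ι-∣∣ (form n) ⟩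
    ι (+ ℤ.∣ form n ∣)                ≤⟨ ι-mono-≤ (ℤ.+≤+ (form≤C n)) ⟩
    ι (+ C)                           ∎)
    where
    open ≤-Reasoning
    open +-*-Solver
    C = proj₁ ∣form∣-bounded
    form≤C = proj₂ ∣form∣-bounded
    N = proj₁ (archimedean ε 0<ε C)
    C<εN = proj₂ (archimedean ε 0<ε C)
    u : ℕ → ℚ
    u n = y n * y n - X
    tq² : ℕ → ℤ
    tq² n = t ℤ.* (den a n ℤ.* den a n)
    n≤tq² : ∀ n → + n ℤ.≤ tq² n
    n≤tq² n = ℤ.≤-trans (k≤den (pos ∘ suc) n) (ℤ.≤-trans
      (i≤j*i 0≤q (1≤den (bounds pos n)))
      (i≤j*i (0≤*ℤ 0≤q 0≤q) (1≤den (bounds pos k))))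
      where 0≤q = 1≤⇒0≤ (1≤den (bounds pos n))
    u*tq²≡form : ∀ n → u n * ι (tq² n) ≡ ι (form n)
    u*tq²≡form n = begin-equality
      u n * ι (tq² n)                               ≡⟨ cong (u n *_) (ι-*-* t (den a n)) ⟩
      u n * (ι t * (q * q))                         ≡⟨ solve 4 (λ y X t q → (y :* y :+ :- X) :* (t :* (q :* q)) :=
                                                         t :* ((y :* q) :* (y :* q)) :+ :- (t :* X :* (q :* q))) refl (y n) X (ι t) q ⟩
      ι t * (y n * q * (y n * q)) - ι t * X * (q * q) ≡⟨ cong₂ (λ v w → ι t * (v * v) - w * (q * q))
                                                           (convergent*den≡num {a} (pos ∘ suc) n) tX≡E ⟩
      ι t * (ι (num a n) * ι (num a n)) - ι E * (q * q) ≡⟨ cong₂ _-_ (ι-*-* t (num a n)) (ι-*-* E (den a n)) ⟨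
      ι (t ℤ.* (num a n ℤ.* num a n)) - ι (E ℤ.* (den a n ℤ.* den a n)) ≡⟨ cong (λ z → ι (t ℤ.* (num a n ℤ.* num a n)) + z) (ι-neg (E ℤ.* (den a n ℤ.* den a n))) ⟨
      ι (t ℤ.* (num a n ℤ.* num a n)) + ι (ℤ.- (E ℤ.* (den a n ℤ.* den a n))) ≡⟨ ι-+ (t ℤ.* (num a n ℤ.* num a n)) (ℤ.- (E ℤ.* (den a n ℤ.* den a n))) ⟨
      ι (form n)                                    ∎
      where
      q = ι (den a n)
      ι-*-* : ∀ i j → ι (i ℤ.* (j ℤ.* j)) ≡ ι i * (ι j * ι j)
      ι-*-* i j = trans (ι-* i (j ℤ.* j)) (cong (ι i *_) (ι-* j j))

-- Transferring the two equations to the divisor t.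

i+1≤j⇒i<j : ∀ {i j} → i ℤ.+ 1ℤ ℤ.≤ j → i ℤ.< j
i+1≤j⇒i<j {i} {j} i+1≤j = ℤ.suc[i]≤j⇒i<j (subst (ℤ._≤ j) (ℤ.+-comm i 1ℤ) i+1≤j)

-- If j ≥ 1 then u ≥ t + 1, and if j ≤ -1 then v ≥ t + 1. The residues run from 1 to t, not from 0,
-- because the last two denominators may coincide, as in [c₀,1].
congruent-in-[1,t] : ∀ {t u v} j → 1ℤ ℤ.≤ u → u ℤ.≤ t → 1ℤ ℤ.≤ v → v ℤ.≤ t → u ≡ v ℤ.+ j ℤ.* t → u ≡ v
congruent-in-[1,t] {t} {u} {v} (+ 0)    1≤u u≤t 1≤v v≤t eq = trans eq (ℤ.+-identityʳ v)
congruent-in-[1,t] {t} {u} {v} +[1+ j ] 1≤u u≤t 1≤v v≤t eq = contradiction u≤t (ℤ.<⇒≱ (i+1≤j⇒i<j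
  (subst₂ ℤ._≤_ (ℤ.+-comm 1ℤ t) (sym eq) (ℤ.+-mono-≤ 1≤v
    (i≤j*i (ℤ.≤-trans (1≤⇒0≤ 1≤u) u≤t) 1≤+[1+ j ])))))
congruent-in-[1,t] {t} {u} {v} -[1+ j ] 1≤u u≤t 1≤v v≤t eq = contradiction v≤t (ℤ.<⇒≱ (i+1≤j⇒i<j
  (subst₂ ℤ._≤_ (ℤ.+-comm 1ℤ t) (trans (cong (ℤ._+ +[1+ j ] ℤ.* t) eq) (lemma v (+[1+ j ]) t))
    (ℤ.+-mono-≤ 1≤u (i≤j*i (ℤ.≤-trans (1≤⇒0≤ 1≤u) u≤t) 1≤+[1+ j ])))))
  where
  lemma : ∀ v j t → v ℤ.+ ℤ.- j ℤ.* t ℤ.+ j ℤ.* t ≡ v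
  lemma = solve-∀

module _ {a} (pos : Positives a) {k}
  (num≡ : num a k ≡ den a k ℤ.* a 0 ℤ.+ den⁻ a k)
  {c} (pos-c : Positives (c ∘ suc)) n {d}
  (num-c≡num : num c n ≡ num a k) (den≡d*den-c : den a k ≡ d ℤ.* den c n) (sign≡ : sign n ≡ sign k)
  where
  private
    p  = num a k
    p⁻ = num⁻ a k
    q  = den a k
    q⁻ = den⁻ a k
    t  = den c n
    u⁻ = num⁻ c n
    t⁻ = den⁻ c n
    e  = sign k
    C  = p ℤ.* a 0 ℤ.+ p⁻
    ba = bounds pos k

    1≤t : ∀ n → 1ℤ ℤ.≤ den c n
    1≤t zero    = ℤ.≤-refl
    1≤t (suc n) = 1≤num (bounds pos-c n)

    det-c : p ℤ.* t⁻ ℤ.- u⁻ ℤ.* t ≡ e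
    det-c = trans (cong (λ z → z ℤ.* t⁻ ℤ.- u⁻ ℤ.* t) (sym num-c≡num)) (trans (det≡sign c n) sign≡)

    -- p is invertible modulo t, and p q⁻ ≡ e ≡ p t⁻, so that p ≡ q⁻ ≡ t⁻.
    num≡den⁻-mod-den : ∃ λ j → p ≡ t⁻ ℤ.+ j ℤ.* t
    -- The factor 1 = (p t⁻ - u⁻ t) e put beside q⁻ - t⁻ produces p (q⁻ - t⁻), which is w t; then
    -- every term except t⁻ has a factor t, and the witness collects the cofactors.
    num≡den⁻-mod-den = d ℤ.* a 0 ℤ.+ (w ℤ.* t⁻ ℤ.- (q⁻ ℤ.- t⁻) ℤ.* u⁻) ℤ.* e , (begin
      p                                                      ≡⟨ num≡ ⟩
      q ℤ.* a 0 ℤ.+ q⁻                                       ≡⟨ cong (λ z → z ℤ.* a 0 ℤ.+ q⁻) den≡d*den-c ⟩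
      d ℤ.* t ℤ.* a 0 ℤ.+ q⁻                                 ≡⟨ lemma₁ d t (a 0) q⁻ t⁻ ⟩
      t⁻ ℤ.+ d ℤ.* a 0 ℤ.* t ℤ.+ (q⁻ ℤ.- t⁻) ℤ.* 1ℤ          ≡⟨ cong (λ z → t⁻ ℤ.+ d ℤ.* a 0 ℤ.* t ℤ.+ (q⁻ ℤ.- t⁻) ℤ.* z) e²≡1 ⟨
      t⁻ ℤ.+ d ℤ.* a 0 ℤ.* t ℤ.+ (q⁻ ℤ.- t⁻) ℤ.* ((p ℤ.* t⁻ ℤ.- u⁻ ℤ.* t) ℤ.* e)
                                                             ≡⟨ lemma₂ d t (a 0) q⁻ t⁻ p u⁻ e ⟩
      t⁻ ℤ.+ d ℤ.* a 0 ℤ.* t ℤ.+ ((p ℤ.* q⁻ ℤ.- p ℤ.* t⁻) ℤ.* t⁻ ℤ.- (q⁻ ℤ.- t⁻) ℤ.* u⁻ ℤ.* t) ℤ.* e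
                                                             ≡⟨ cong (λ z → t⁻ ℤ.+ d ℤ.* a 0 ℤ.* t ℤ.+ (z ℤ.* t⁻ ℤ.- (q⁻ ℤ.- t⁻) ℤ.* u⁻ ℤ.* t) ℤ.* e) pq⁻-pt⁻ ⟩
      t⁻ ℤ.+ d ℤ.* a 0 ℤ.* t ℤ.+ (w ℤ.* t ℤ.* t⁻ ℤ.- (q⁻ ℤ.- t⁻) ℤ.* u⁻ ℤ.* t) ℤ.* e
                                                             ≡⟨ lemma₃ t⁻ d (a 0) t w q⁻ u⁻ e ⟩
      t⁻ ℤ.+ (d ℤ.* a 0 ℤ.+ (w ℤ.* t⁻ ℤ.- (q⁻ ℤ.- t⁻) ℤ.* u⁻) ℤ.* e) ℤ.* t ∎)
      where
      open ≡-Reasoning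
      w = p⁻ ℤ.* d ℤ.- u⁻
      e²≡1 : (p ℤ.* t⁻ ℤ.- u⁻ ℤ.* t) ℤ.* e ≡ 1ℤ
      e²≡1 = trans (cong (ℤ._* e) det-c) (sign² k)
      pq⁻-pt⁻ : p ℤ.* q⁻ ℤ.- p ℤ.* t⁻ ≡ w ℤ.* t
      pq⁻-pt⁻ = begin
        p ℤ.* q⁻ ℤ.- p ℤ.* t⁻
          ≡⟨ lemma p q⁻ p⁻ q t⁻ u⁻ t ⟩
        p⁻ ℤ.* q ℤ.- u⁻ ℤ.* t ℤ.+ (p ℤ.* q⁻ ℤ.- p⁻ ℤ.* q ℤ.- (p ℤ.* t⁻ ℤ.- u⁻ ℤ.* t))
          ≡⟨ cong₂ (λ x y → p⁻ ℤ.* x ℤ.- u⁻ ℤ.* t ℤ.+ y) den≡d*den-c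
               (ℤ.i≡j⇒i-j≡0 (trans (det≡sign a k) (sym det-c))) ⟩
        p⁻ ℤ.* (d ℤ.* t) ℤ.- u⁻ ℤ.* t ℤ.+ 0ℤ
          ≡⟨ lemma′ p⁻ d t u⁻ ⟩
        w ℤ.* t ∎
        where
        lemma : ∀ p q⁻ p⁻ q t⁻ u⁻ t → p ℤ.* q⁻ ℤ.- p ℤ.* t⁻ ≡
          p⁻ ℤ.* q ℤ.- u⁻ ℤ.* t ℤ.+ (p ℤ.* q⁻ ℤ.- p⁻ ℤ.* q ℤ.- (p ℤ.* t⁻ ℤ.- u⁻ ℤ.* t))
        lemma = solve-∀
        lemma′ : ∀ p⁻ d t u⁻ → p⁻ ℤ.* (d ℤ.* t) ℤ.- u⁻ ℤ.* t ℤ.+ 0ℤ ≡ (p⁻ ℤ.* d ℤ.- u⁻) ℤ.* t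
        lemma′ = solve-∀
      lemma₁ : ∀ d t x q⁻ t⁻ → d ℤ.* t ℤ.* x ℤ.+ q⁻ ≡ t⁻ ℤ.+ d ℤ.* x ℤ.* t ℤ.+ (q⁻ ℤ.- t⁻) ℤ.* 1ℤ
      lemma₁ = solve-∀
      lemma₂ : ∀ d t x q⁻ t⁻ p u⁻ e →
        t⁻ ℤ.+ d ℤ.* x ℤ.* t ℤ.+ (q⁻ ℤ.- t⁻) ℤ.* ((p ℤ.* t⁻ ℤ.- u⁻ ℤ.* t) ℤ.* e) ≡
        t⁻ ℤ.+ d ℤ.* x ℤ.* t ℤ.+ ((p ℤ.* q⁻ ℤ.- p ℤ.* t⁻) ℤ.* t⁻ ℤ.- (q⁻ ℤ.- t⁻) ℤ.* u⁻ ℤ.* t) ℤ.* e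
      lemma₂ = solve-∀
      lemma₃ : ∀ t⁻ d x t w q⁻ u⁻ e →
        t⁻ ℤ.+ d ℤ.* x ℤ.* t ℤ.+ (w ℤ.* t ℤ.* t⁻ ℤ.- (q⁻ ℤ.- t⁻) ℤ.* u⁻ ℤ.* t) ℤ.* e ≡
        t⁻ ℤ.+ (d ℤ.* x ℤ.+ (w ℤ.* t⁻ ℤ.- (q⁻ ℤ.- t⁻) ℤ.* u⁻) ℤ.* e) ℤ.* t
      lemma₃ = solve-∀

  divisor-num≡ : num c n ≡ den c n ℤ.* c 0 ℤ.+ den⁻ c n
  divisor-num≡ = by n refl
    where
    by : ∀ m → n ≡ m → num c n ≡ den c n ℤ.* c 0 ℤ.+ den⁻ c n
    -- Here t⁻ = 0 lies outside [1,t], so the congruence argument does not apply; the equation reads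
    -- c₀ = 1 c₀ + 0.
    by zero    refl = sym (trans (ℤ.+-identityʳ (1ℤ ℤ.* c 0)) (ℤ.*-identityˡ (c 0)))
    by (suc m) refl = trans
      (cong (λ z → c 0 ℤ.* t ℤ.+ z) (congruent-in-[1,t] (j ℤ.- c 0)
        (1≤den bc) (den≤num bc) (1≤num⁻ bc) (num⁻≤num bc)
        (begin
          den (c ∘ suc) m                             ≡⟨ lemma₁ (den (c ∘ suc) m) (c 0 ℤ.* t) ⟩
          num c n ℤ.- c 0 ℤ.* t                       ≡⟨ cong (ℤ._- c 0 ℤ.* t) (trans num-c≡num p≡) ⟩
          t⁻ ℤ.+ j ℤ.* t ℤ.- c 0 ℤ.* t                ≡⟨ lemma₂ t⁻ j t (c 0) ⟩
          t⁻ ℤ.+ (j ℤ.- c 0) ℤ.* t                    ∎)))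
      (cong (ℤ._+ t⁻) (ℤ.*-comm (c 0) t))
      where
      open ≡-Reasoning
      bc = bounds pos-c m
      j  = proj₁ num≡den⁻-mod-den
      p≡ = proj₂ num≡den⁻-mod-den
      lemma₁ : ∀ x y → x ≡ y ℤ.+ x ℤ.- y
      lemma₁ = solve-∀
      lemma₂ : ∀ x j t y → x ℤ.+ j ℤ.* t ℤ.- y ℤ.* t ≡ x ℤ.+ (j ℤ.- y) ℤ.* t
      lemma₂ = solve-∀

  -- Multiplied by t, both sides become p² - e: the left by the determinant of `c` and
  -- `divisor-num≡`, the right by the determinant of `a` and `num≡`.
  divisor-norm : num c n ℤ.* c 0 ℤ.+ num⁻ c n ≡ d ℤ.* C
  divisor-norm = ℤ.*-cancelˡ-≡ t _ _ {{ℤ.>-nonZero (ℤ.suc[i]≤j⇒i<j (1≤t n))}} (begin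
    t ℤ.* (num c n ℤ.* c 0 ℤ.+ u⁻)          ≡⟨ lemma t (num c n) (c 0) u⁻ t⁻ ⟩
    num c n ℤ.* (t ℤ.* c 0 ℤ.+ t⁻) ℤ.- (num c n ℤ.* t⁻ ℤ.- u⁻ ℤ.* t)
                                            ≡⟨ cong₂ (λ x y → num c n ℤ.* x ℤ.- y) (sym divisor-num≡) (trans (det≡sign c n) sign≡) ⟩
    num c n ℤ.* num c n ℤ.- e               ≡⟨ cong (λ z → z ℤ.* z ℤ.- e) num-c≡num ⟩
    p ℤ.* p ℤ.- e                           ≡⟨ cong₂ (λ x y → p ℤ.* x ℤ.- y) num≡ (sym (det≡sign a k)) ⟩
    p ℤ.* (q ℤ.* a 0 ℤ.+ q⁻) ℤ.- (p ℤ.* q⁻ ℤ.- p⁻ ℤ.* q)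
                                            ≡⟨ lemma q p (a 0) p⁻ q⁻ ⟨
    q ℤ.* C                                 ≡⟨ cong (ℤ._* C) den≡d*den-c ⟩
    d ℤ.* t ℤ.* C                           ≡⟨ lemma′ d t C ⟩
    t ℤ.* (d ℤ.* C)                         ∎)
    where
    open ≡-Reasoning
    lemma : ∀ t p x p⁻ t⁻ → t ℤ.* (p ℤ.* x ℤ.+ p⁻) ≡ p ℤ.* (t ℤ.* x ℤ.+ t⁻) ℤ.- (p ℤ.* t⁻ ℤ.- p⁻ ℤ.* t)
    lemma = solve-∀
    lemma′ : ∀ d t C → d ℤ.* t ℤ.* C ≡ t ℤ.* (d ℤ.* C)
    lemma′ = solve-∀

  module _ (1≤d : 1ℤ ℤ.≤ d) where

    -- The chain is t ≤ q ≤ p ≤ p a₀ < C ≤ d C.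
    t<norm : t ℤ.< num c n ℤ.* c 0 ℤ.+ num⁻ c n
    t<norm = i+1≤j⇒i<j (subst (t ℤ.+ 1ℤ ℤ.≤_) (sym divisor-norm) (ℤ.≤-trans
      (ℤ.+-mono-≤ (ℤ.≤-trans t≤p (subst (p ℤ.≤_) (ℤ.*-comm (a 0) p) (i≤j*i 0≤p (pos 0)))) (1≤num⁻ ba))
      (i≤j*i 0≤C 1≤d)))
      where
      0≤p = 1≤⇒0≤ (1≤num ba)
      t≤p : t ℤ.≤ p
      t≤p = ℤ.≤-trans (subst (t ℤ.≤_) (sym den≡d*den-c) (i≤j*i (1≤⇒0≤ (1≤t n)) 1≤d)) (den≤num ba)
      0≤C : 0ℤ ℤ.≤ C
      0≤C = ℤ.+-mono-≤ (0≤*ℤ 0≤p (1≤⇒0≤ (pos 0))) (1≤⇒0≤ (1≤num⁻ ba))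

    -- For n = 0, c₀ is p. For n > 0, a negative c₀ would force t⁻ = p - t c₀ > t. The inequality p
    -- ≥ t alone does not exclude c₀ = 0, since 1 = [0,1]; but then the norm would be u⁻ ≤ t,
    -- against `t<norm`.
    divisor-head : 1ℤ ℤ.≤ c 0
    divisor-head = by n refl (c 0) refl
      where
      by : ∀ m → n ≡ m → ∀ z → c 0 ≡ z → 1ℤ ℤ.≤ c 0
      by m       _    +[1+ j ] eq = subst (1ℤ ℤ.≤_) (sym eq) 1≤+[1+ j ]
      by zero    refl (+ 0)    eq = subst (1ℤ ℤ.≤_) (sym num-c≡num) (1≤num ba)
      by zero    refl -[1+ j ] eq = subst (1ℤ ℤ.≤_) (sym num-c≡num) (1≤num ba)
      by (suc m) refl (+ 0)    eq = contradiction (ℤ.<-≤-trans t<norm norm≤t) (ℤ.<-irrefl refl)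
        where
        bc = bounds pos-c m
        lemma : ∀ p u v → p ℤ.* 0ℤ ℤ.+ (0ℤ ℤ.* u ℤ.+ v) ≡ v
        lemma = solve-∀
        norm≤t : num c n ℤ.* c 0 ℤ.+ num⁻ c n ℤ.≤ t
        norm≤t = subst (ℤ._≤ t) (sym (trans
          (cong (λ z → num c n ℤ.* z ℤ.+ (z ℤ.* num⁻ (c ∘ suc) m ℤ.+ den⁻ (c ∘ suc) m)) eq)
          (lemma (num c n) (num⁻ (c ∘ suc) m) (den⁻ (c ∘ suc) m))))
          (ℤ.≤-trans (den⁻≤den bc) (den≤num bc))
      by (suc m) refl -[1+ j ] eq = contradiction (num⁻≤num bc) (ℤ.<⇒≱ (i+1≤j⇒i<j
        (subst₂ ℤ._≤_ (ℤ.+-comm 1ℤ t) (trans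
          (cong (ℤ._+ (+[1+ j ] ℤ.* t)) (trans (sym num-c≡num) (trans divisor-num≡ (cong (λ z → t ℤ.* z ℤ.+ t⁻) eq))))
          (lemma t (+[1+ j ]) t⁻))
          (ℤ.+-mono-≤ (1≤num ba) (i≤j*i (1≤⇒0≤ (1≤t n)) 1≤+[1+ j ])))))
        where
        bc = bounds pos-c m
        lemma : ∀ t j t⁻ → t ℤ.* ℤ.- j ℤ.+ t⁻ ℤ.+ j ℤ.* t ≡ t⁻
        lemma = solve-∀

-- Parity, vectors and the indexing of periodic sequences.

sign-%2 : ∀ n → sign n ≡ sign (n % 2)
sign-%2 zero          = refl
sign-%2 (suc zero)    = refl
sign-%2 (suc (suc n)) = trans (ℤ.neg-involutive (sign n)) (sign-%2 n)

lookup-∷ʳ-inject₁ : ∀ {A : Set} {n} (xs : Vec A n) x i → lookup (xs ∷ʳ x) (inject₁ i) ≡ lookup xs i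
lookup-∷ʳ-inject₁ (y ∷ xs) x zero    = refl
lookup-∷ʳ-inject₁ (y ∷ xs) x (suc i) = lookup-∷ʳ-inject₁ xs x i

lookup-∷ʳ-fromℕ : ∀ {A : Set} {n} (xs : Vec A n) x → lookup (xs ∷ʳ x) (fromℕ n) ≡ x
lookup-∷ʳ-fromℕ []       x = refl
lookup-∷ʳ-fromℕ (y ∷ xs) x = lookup-∷ʳ-fromℕ xs x

lookup-∷ʳ⁺ : ∀ {A : Set} {P : A → Set} {n} {xs : Vec A n} {x} → All P xs → P x → ∀ i → P (lookup (xs ∷ʳ x) i)
lookup-∷ʳ⁺ []         px zero    = px
lookup-∷ʳ⁺ (py ∷ pxs) px zero    = py
lookup-∷ʳ⁺ (py ∷ pxs) px (suc i) = lookup-∷ʳ⁺ pxs px i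

-- The first n + 1 terms do not reach the closing term z of the block, so z is arbitrary: both 2c₀
-- and the provisional 2 in `γ₁` are covered.
convergent≡cf : ∀ a {n} (cs : Vec ℤ n) {z} →
  (∀ i → a (suc i) ≡ lookup (cs ∷ʳ z) (i mod suc n)) → convergent a n ≡ cf (a 0 ∷ cs)
convergent≡cf a {n} cs {z} a≡ = cong (λ v → cf (a 0 ∷ v))
  (trans (tabulate-cong λ j → trans (a≡ (toℕ j))
      (trans (cong (lookup (cs ∷ʳ z)) (toℕ-mod j)) (lookup-∷ʳ-inject₁ cs z j)))
    (tabulate∘lookup cs))
  where
  toℕ-mod : ∀ (j : Fin n) → toℕ j mod suc n ≡ inject₁ j
  toℕ-mod j = toℕ-injective (trans (toℕ-fromℕ< (m%n<n (toℕ j) (suc n)))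
    (trans (m<n⇒m%n≡m (ℕ.m<n⇒m<1+n (toℕ<n j))) (sym (toℕ-inject₁ j))))

positive⇒1≤ : ∀ {i} → ℤ.Positive i → 1ℤ ℤ.≤ i
positive⇒1≤ {+[1+ n ]} _ = 1≤+[1+ n ]

periodic-tail-positive : ∀ {m} b₀ {bs : Vec ℤ m} → All ℤ.Positive bs → 1ℤ ℤ.≤ b₀ →
  ∀ i → ℤ.Positive (periodic (b₀ ∷ bs) (suc i))
periodic-tail-positive {m} +[1+ _ ] bs>0 _ i = lookup-∷ʳ⁺ bs>0 _ (i mod suc m)
periodic-tail-positive (+ 0)        _ (ℤ.+≤+ ())

mod-cong : ∀ i j n .{{_ : NonZero n}} → i % n ≡ j % n → i mod n ≡ j mod n
mod-cong i j n eq = fromℕ<-cong _ _ eq (m%n<n i n) (m%n<n j n)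

periodic-period : ∀ {m} (b : Vec ℤ (suc m)) l .{{_ : NonZero l}} → Period (periodic b) (l *ℕ suc m ∸ 1)
periodic-period {m} (b₀ ∷ bs) (suc l) =
  trans (cong (lookup (bs ∷ʳ + 2 ℤ.* b₀)) last)
    (trans (lookup-∷ʳ-fromℕ bs (+ 2 ℤ.* b₀)) (double b₀)) ,
  λ i → cong (lookup (bs ∷ʳ + 2 ℤ.* b₀)) (mod-cong (m ℕ.+ l *ℕ suc m ℕ.+ suc i) i (suc m) (shift i))
  where
  double : ∀ x → + 2 ℤ.* x ≡ x ℤ.+ x
  double = solve-∀
  -- `periodic` reads term i + 1 at position i of the block, so the term that closes a whole number
  -- of periods sits at position m, the place of 2b₀.
  last : (m ℕ.+ l *ℕ suc m) mod suc m ≡ fromℕ m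
  last = toℕ-injective (trans (toℕ-fromℕ< (m%n<n (m ℕ.+ l *ℕ suc m) (suc m)))
    (trans ([m+kn]%n≡m%n m l (suc m)) (trans (m<n⇒m%n≡m (ℕ.n<1+n m)) (sym (toℕ-fromℕ m)))))
  shift : ∀ i → (m ℕ.+ l *ℕ suc m ℕ.+ suc i) % suc m ≡ i % suc m
  shift i = trans (cong (_% suc m) (trans (ℕ.+-suc (m ℕ.+ l *ℕ suc m) i) (ℕ.+-comm (suc l *ℕ suc m) i)))
    ([m+kn]%n≡m%n i (suc l) (suc m))

-- Application to D/Q and the given divisor.

theorem3 : (D Q : ℕ) .{{_ : NonZero D}} .{{_ : NonZero Q}} →
    Coprime D Q →
    1ℚ < + D / Q →
    (∀ (x : ℚ) → x * x ≢ + D / Q) →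
    (m : ℕ) (b : Vec ℤ (suc m)) →
    SqrtExpansion (+ D / Q) b →
    (∀ (m′ : ℕ) (b′ : Vec ℤ (suc m′)) → SqrtExpansion (+ D / Q) b′ → m ≤ m′) →
    (k l : ℕ) .{{_ : NonZero l}} →
    k ≡ l *ℕ suc m ∸ 1 →
    (t : ℕ) .{{_ : NonZero t}} →
    t ∣ s (periodic b) k →
    (n : ℕ) (c : Vec ℤ (suc n)) →
    Simple c →
    cf c ≡ r (periodic b) k / t →
    n % 2 ≡ k % 2 →
    (+ s (periodic b) k / t) · √ (+ D / Q) ≐ periodic c
theorem3 D Q _ _ irrational m b@(b₀ ∷ bs) (b₀>0 ∷ _ , b>0 , b⟶√x) _ k l refl t t∣s n (c₀ ∷ cs) cs>0 cf≡ n≡k =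
  periodic-tail-positive c₀ cs>0 1≤c₀ ,
  null⇒⟶√ w x (1≤convergent pos-γ)
    (null-convergent pos-γ {n} period-γ (divisor-num≡ pos {k} num≡ {γ} (pos-γ ∘ suc) n {d} num-γ≡ den≡ sign≡) norm-γ)
  where
  x = + D / Q
  α = periodic b
  γ = periodic (c₀ ∷ cs)
  w = + s α k / t
  d = + quotient t∣s

  pos : Positives α
  pos zero    = positive⇒1≤ b₀>0
  pos (suc i) = positive⇒1≤ (b>0 i)

  α-equations = period-equations pos {k} (periodic-period b l) (ℚ.positive⁻¹ x) irrational b⟶√x
  num≡ = proj₁ α-equations

  1≤t : 1ℤ ℤ.≤ + t
  1≤t = ℤ.+≤+ (ℕ.>-nonZero⁻¹ t)

  r≡ : r α k ≡ num α k
  r≡ = proj₁ (convergent-lowest-terms (pos ∘ suc) k)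

  den≡dt : den α k ≡ d ℤ.* + t
  den≡dt = trans (sym (proj₂ (convergent-lowest-terms (pos ∘ suc) k)))
    (trans (cong +_ (_∣_.equality t∣s)) (ℤ.pos-* (quotient t∣s) t))

  1≤d : 1ℤ ℤ.≤ d
  1≤d = by (quotient t∣s) refl
    where
    by : ∀ q → quotient t∣s ≡ q → 1ℤ ℤ.≤ d
    by zero    eq = contradiction
      (subst (1ℤ ℤ.≤_) (trans den≡dt (cong (λ q → + q ℤ.* + t) eq)) (1≤den (bounds pos k)))
      λ { (ℤ.+≤+ ()) }
    by (suc q) eq = subst (λ z → 1ℤ ℤ.≤ + z) (sym eq) 1≤+[1+ q ]

  sign≡ : sign n ≡ sign k
  sign≡ = trans (sign-%2 n) (trans (cong sign n≡k) (sym (sign-%2 k)))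

  -- Two fractions in lowest terms with the same value are compared. The sequence is left general
  -- because `γ₁` is needed to prove c₀ ≥ 1 before `γ` is known to be positive.
  num-den : ∀ {a} → Positives (a ∘ suc) → convergent a n ≡ cf (c₀ ∷ cs) →
    num a n ≡ num α k × den a n ≡ + t
  num-den {a} pos-a eq =
    let ↥≡num , ↧≡den = convergent-lowest-terms pos-a n
        ↥≡r , ↧≡t = lowest-terms (convergent a n) 1≤t coprime
          (trans (cong (_* ι (+ t)) (trans eq (trans cf≡ (cong (_/ t) r≡)))) (n/d*d≡n (num α k) t))
    in trans (sym ↥≡num) ↥≡r , trans (sym ↧≡den) ↧≡t
    where
    coprime : ℤ.Coprime (num α k) (+ t)
    -- Since sₖ = d t, moving d into the other factor turns `det α k` into a determinant that
    -- contains rₖ and t.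
    coprime = det⇒coprime (num α k) (num⁻ α k ℤ.* d) (+ t) (den⁻ α k)
      (trans (cong (λ z → num α k ℤ.* den⁻ α k ℤ.- z)
        (trans (ℤ.*-assoc (num⁻ α k) d (+ t)) (cong (num⁻ α k ℤ.*_) (sym den≡dt))))
        (det≡sign α k)) (sign² k)

  -- [c₀,{c₁,…,cₙ,2}]: the partial quotient 2 stands in for 2c₀, not yet known to be positive.
  γ₁ : ℕ → ℤ
  γ₁ zero    = c₀
  γ₁ (suc i) = periodic (1ℤ ∷ cs) (suc i)

  pos-γ₁ : Positives (γ₁ ∘ suc)
  pos-γ₁ i = positive⇒1≤ (periodic-tail-positive 1ℤ cs>0 ℤ.≤-refl i)

  1≤c₀ : 1ℤ ℤ.≤ c₀
  1≤c₀ = let num≡num , den≡t = num-den {γ₁} pos-γ₁ (convergent≡cf γ₁ cs λ _ → refl) in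
    divisor-head pos {k} num≡ {γ₁} pos-γ₁ n {d} num≡num (trans den≡dt (cong (d ℤ.*_) (sym den≡t))) sign≡ 1≤d

  pos-γ : Positives γ
  pos-γ zero    = 1≤c₀
  pos-γ (suc i) = positive⇒1≤ (periodic-tail-positive c₀ cs>0 1≤c₀ i)

  period-γ : Period γ n
  period-γ = subst (Period γ) (ℕ.+-identityʳ n) (periodic-period (c₀ ∷ cs) 1)

  num-den-γ = num-den {γ} (pos-γ ∘ suc) (convergent≡cf γ cs λ _ → refl)
  num-γ≡ = proj₁ num-den-γ

  den≡ : den α k ≡ d ℤ.* den γ n
  den≡ = trans den≡dt (cong (d ℤ.*_) (sym (proj₂ num-den-γ)))

  w≡d : w ≡ ι d
  w≡d = *-cancelʳ (0<ι 1≤t) (trans (n/d*d≡n (+ s α k) t)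
    (trans (cong ι (trans (proj₂ (convergent-lowest-terms (pos ∘ suc) k)) den≡dt)) (ι-* d (+ t))))

  norm-γ : ι (den γ n) * (w * w * x) ≡ ι (num γ n ℤ.* γ 0 ℤ.+ num⁻ γ n)
  norm-γ = begin
    T * (w * w * x)        ≡⟨ cong (λ v → T * (v * v * x)) w≡d ⟩
    T * (ι d * ι d * x)    ≡⟨ solve 3 (λ T d x → T :* (d :* d :* x) := d :* (d :* T :* x)) refl T (ι d) x ⟩
    ι d * (ι d * T * x)    ≡⟨ cong (λ v → ι d * (v * x)) (trans (cong ι den≡) (ι-* d (den γ n))) ⟨
    ι d * (ι (den α k) * x) ≡⟨ cong (ι d *_) (proj₂ α-equations) ⟩
    ι d * ι C              ≡⟨ ι-* d C ⟨
    ι (d ℤ.* C)            ≡⟨ cong ι (divisor-norm pos {k} num≡ {γ} (pos-γ ∘ suc) n {d} num-γ≡ den≡ sign≡) ⟨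
    ι (num γ n ℤ.* γ 0 ℤ.+ num⁻ γ n) ∎
    where
    open ≡-Reasoning
    open +-*-Solver
    T = ι (den γ n)
    C = num α k ℤ.* α 0 ℤ.+ num⁻ α k
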